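{- Let $a,b,c\geq 4$ be integers and let $FCS_{a,b,c}$ be the zigzag-edge coronoid fused with starphene (defined in the context). Then the edge metric dimension of $FCS_{a,b,c}$ is $3$, i.e. $\mathrm{edim}(FCS_{a,b,c})=3$.
   Context: All graphs are finite, simple, connected and undirected; $d(x,y)$ denotes the shortest-path distance between vertices $x,y$. Edge metric dimension: the distance between a vertex $\alpha$ and an edge $\epsilon=wz$ is $d(\alpha,\epsilon)=\min\{d(\alpha,w),d(\alpha,z)\}$. A vertex $\alpha$ resolves two distinct edges $\epsilon_1,\epsilon_2$ if $d(\alpha,\epsilon_1)\neq d(\alpha,\epsilon_2)$. A set $U_E\subseteq V(\Gamma)$ is an edge metric generator of $\Gamma$ if every pair of distinct edges of $\Gamma$ is resolved by some element of $U_E$. The edge metric dimension $\mathrm{edim}(\Gamma)$ is the minimum cardinality of an edge metric generator of $\Gamma$. The graph $FCS_{a,b,c}$ (a benzenoid/hexagonal system, regarded as a graph whose vertices are the atoms and whose edges are the bonds): take the zigzag-edge (hollow) coronoid $HC_{a,b,c}$, the benzenoid obtained by fusing six linear polyacene chains containing $a,b,c,a,b,c$ hexagons respectively into a closed loop, consecutive chains sharing their terminal (corner) hexagon, so that the structure has a central hole. Inside the hole place a starphene: a central hexagon from which three linear polyacene arms emanate, containing $a-2$, $b-2$ and $c-2$ hexagons respectively (not counting the central hexagon), the arm with $a-2$ hexagons running parallel to the chains of $a$ hexagons (and similarly for $b$, $c$); the terminal hexagon of each arm lies in a corner of the hole and is fused to the coronoid by sharing three consecutive edges of the hole boundary with it.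 The resulting graph $FCS_{a,b,c}$ has $6(2a+2b+2c-9)$ vertices ($6(a+b+c-6)$ of degree $2$ and $6(a+b+c-3)$ of degree $3$), $3(5a+5b+5c-21)$ edges, and $3a+3b+3c-11$ hexagonal faces. -}

module Defs where

open import Data.Nat using (ℕ; zero; suc; _≤_; _⊓_; _∸_)
open import Data.Integer using (ℤ; +_; -[1+_]; _+_; _-_; _*_)
open import Data.Product using (_×_; _,_; Σ; proj₁; proj₂)
open import Data.Sum using (_⊎_)
open import Data.List using (List; []; _∷_; _++_; concatMap; length)
open import Data.List.Membership.Propositional using (_∈_)
open import Data.List.Relation.Unary.All using (All)
open import Data.List.Relation.Unary.Any using (Any)
open import Data.List.Relation.Unary.Unique.Propositional using (Unique)
open import Relation.Binary.PropositionalEquality using (_≡_; _≢_)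
open import Relation.Nullary using (¬_)

-- Finite simple graphs on lattice points, given by a vertex list and an
-- edge list (each edge an (unordered) pair of vertices, listed in some
-- orientation; duplicates in the lists are harmless).

Vtx : Set
Vtx = ℤ × ℤ

record Graph : Set where
  field
    verts : List Vtx
    edges : List (Vtx × Vtx)
open Graph public

Adj : Graph → Vtx → Vtx → Set
Adj G x y = (x , y) ∈ edges G ⊎ (y , x) ∈ edges G

data Walk (G : Graph) : Vtx → Vtx → ℕ → Set where
  here : ∀ {x} → x ∈ verts G → Walk G x x 0
  step : ∀ {x y z n} → Adj G x y → Walk G y z n → Walk G x z (suc n)

IsDist : Graph → Vtx → Vtx → ℕ → Set
IsDist G x y n = Walk G x y n × (∀ m → Walk G x y m → n ≤ m)

IsEDist : Graph → Vtx → Vtx × Vtx → ℕ → Set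
IsEDist G α (w , z) k =
  Σ ℕ λ m → Σ ℕ λ n → IsDist G α w m × IsDist G α z n × k ≡ m ⊓ n

Resolves : Graph → Vtx → Vtx × Vtx → Vtx × Vtx → Set
Resolves G α e₁ e₂ =
  Σ ℕ λ k₁ → Σ ℕ λ k₂ → IsEDist G α e₁ k₁ × IsEDist G α e₂ k₂ × k₁ ≢ k₂

SameEdge : Vtx × Vtx → Vtx × Vtx → Set
SameEdge (w , z) (w' , z') = (w ≡ w' × z ≡ z') ⊎ (w ≡ z' × z ≡ w')

IsEdgeMetricGenerator : Graph → List Vtx → Set
IsEdgeMetricGenerator G U =
  Unique U × All (λ α → α ∈ verts G) U ×
  (∀ e₁ e₂ → e₁ ∈ edges G → e₂ ∈ edges G → ¬ SameEdge e₁ e₂ →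
     Any (λ α → Resolves G α e₁ e₂) U)

EdgeMetricDim : Graph → ℕ → Set
EdgeMetricDim G k =
  (Σ (List Vtx) λ U → length U ≡ k × IsEdgeMetricGenerator G U) ×
  (∀ U → IsEdgeMetricGenerator G U → k ≤ length U)

-- The hexagonal (honeycomb) lattice in "brick-wall" form: vertices ℤ²,
-- horizontal edges (x,y)–(x+1,y), vertical edges (x,y)–(x,y+1) when x+y
-- is even.  A hexagonal face with axial coordinates (u,v) has base point
-- (X,Y) = (2u+v, v) and vertices (X+i, Y+j), i ∈ {0,1,2}, j ∈ {0,1}.
-- Neighbouring faces of (u,v): (u±1,v), (u,v±1), (u+1,v-1), (u-1,v+1).

Hex : Set
Hex = ℤ × ℤ

-1ℤ : ℤ
-1ℤ = -[1+ 0 ]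

base : Hex → Vtx
base (u , v) = ((+ 2) * u + v , v)

hexVerts : Hex → List Vtx
hexVerts h with base h
... | (X , Y) =
  (X , Y) ∷ (X + + 1 , Y) ∷ (X + + 2 , Y) ∷
  (X , Y + + 1) ∷ (X + + 1 , Y + + 1) ∷ (X + + 2 , Y + + 1) ∷ []

hexEdges : Hex → List (Vtx × Vtx)
hexEdges h with base h
... | (X , Y) =
  ((X , Y) , (X + + 1 , Y)) ∷
  ((X + + 1 , Y) , (X + + 2 , Y)) ∷
  ((X , Y + + 1) , (X + + 1 , Y + + 1)) ∷
  ((X + + 1 , Y + + 1) , (X + + 2 , Y + + 1)) ∷
  ((X , Y) , (X , Y + + 1)) ∷
  ((X + + 2 , Y) , (X + + 2 , Y + + 1)) ∷ []

chain : Hex → Hex → ℕ → List Hex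
chain p d zero = []
chain (u , v) (du , dv) (suc n) = (u , v) ∷ chain (u + du , v + dv) (du , dv) n

benzenoid : List Hex → Graph
benzenoid hs = record { verts = concatMap hexVerts hs ; edges = concatMap hexEdges hs }

-- directions: e1 = (1,0), e2 = (0,1), e3 = e2 - e1 = (-1,1)
-- Zigzag-edge coronoid HC_{a,b,c}: six chains of a,b,c,a,b,c hexagons in
-- directions e1, e2, e3, -e1, -e2, -e3, consecutive chains sharing their
-- corner hexagon.
coronoidHexes : ℕ → ℕ → ℕ → List Hex
coronoidHexes a b c =
  chain (+ 0 , + 0) (+ 1 , + 0) a ++
  chain (A - + 1 , + 0) (+ 0 , + 1) b ++
  chain (A - + 1 , B - + 1) (-1ℤ , + 1) c ++
  chain (A - C , B + C - + 2) (-1ℤ , + 0) a ++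
  chain (+ 1 - C , B + C - + 2) (+ 0 , -1ℤ) b ++
  chain (+ 1 - C , C - + 1) (+ 1 , -1ℤ) c
  where
    A = + a
    B = + b
    C = + c

-- Starphene in the hole: central hexagon Z = (a-c, c-1); arms of a-2
-- hexagons in direction -e1, b-2 in direction e2, c-2 in direction -e3
-- (so arms are parallel to the chains of a, b, c hexagons respectively);
-- their terminal hexagons are the three hole-corner hexagons
-- (2-c, c-1), (a-c, b+c-3), (a-2, 1).
starpheneHexes : ℕ → ℕ → ℕ → List Hex
starpheneHexes a b c =
  chain Z (-1ℤ , + 0) (a ∸ 1) ++
  chain Z (+ 0 , + 1) (b ∸ 1) ++
  chain Z (+ 1 , -1ℤ) (c ∸ 1)
  where
    Z : Hex
    Z = (+ a - + c , + c - + 1)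

FCS : ℕ → ℕ → ℕ → Graph
FCS a b c = benzenoid (coronoidHexes a b c ++ starpheneHexes a b c)

{-# OPTIONS --safe #-}
module Submission where

-- Write a = 3 + A, b = 3 + B, c = 3 + C.  For A = B = C = 0 the graph is a
-- 54-vertex benzenoid, the core, which is isometric in the honeycomb lattice.
-- The general graph is the core cut along nine edges (rungs), with a straight
-- ribbon of A, B or C hexagons inserted at each cut.  The pieces left by the cuts
-- (junctions) and the ribbons form a cube without one vertex, so that all ways
-- round a hole between two clusters Pᵢ (where an arm meets the coronoid) have
-- equal length.  Hence the distance from a vertex x of a cluster to a vertex y is
-- the lattice distance of their positions in the core plus a linear function of
-- A, B, C and the index of y on its ribbon.  This is verified symbolically: the
-- function changes by at most 1 along each edge, and away from x some neighbour
-- has a smaller value.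
--
-- Upper bound: one vertex per cluster; the edges fall into 108 linear families,
-- and the three distances separate any two by a small integer combination that
-- is positive on the parameter range or nonzero modulo 2 or 4.
--
-- Lower bound: which edges of a cluster are equidistant from a vertex α depends
-- only on the core position of α, and for any two core positions some pair of
-- edges of a common cluster is equidistant from both.

open import Defs
open import Data.Nat using (ℕ; _≤_)

open import Algebra.Bundles using (AbelianGroup)
open import Data.Bool using (Bool; true; false; if_then_else_; not; _xor_)
import Data.Bool.Properties as Bool
open import Data.Fin using (Fin; zero; suc; #_)
import Data.Fin.Properties as Fin
open import Data.Integer using (ℤ; +_; -[1+_]; -_; _+_; _-_; _*_; _⊔_; _⊓_; ∣_∣; 0ℤ; 1ℤ; +≤+; -≤+; +<+; drop‿+≤+; ≢-nonZero)
import Data.Integer as ℤ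
open import Data.Integer.DivMod using (_%ℕ_)
open import Data.Integer.Divisibility.Signed using (_∣_; _∣?_; divides; ∣m∣n⇒∣m+n; ∣m⇒∣m*n; ∣m+n∣n⇒∣m)
import Data.Integer.Properties as ℤ
open import Data.Integer.Solver using (module +-*-Solver)
open import Data.List using (List; []; _∷_; _++_; map; concatMap; filter; length)
import Data.List.Membership.DecPropositional as DecMembership
open import Data.List.Membership.Propositional using (_∈_; lose; find)
open import Data.List.Membership.Propositional.Properties using (∈-++⁺ˡ; ∈-++⁺ʳ; ∈-++⁻; ∈-concatMap⁺; ∈-concatMap⁻; ∈-map⁺; ∈-map⁻; ∈-filter⁻)
open import Data.List.Relation.Unary.All as All using (All; []; _∷_; all?)
import Data.List.Relation.Unary.All.Properties as All
open import Data.List.Relation.Unary.AllPairs as AllPairs using (AllPairs; []; _∷_; allPairs?)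
import Data.List.Relation.Unary.AllPairs.Properties as AllPairs
open import Data.List.Relation.Unary.Any as Any using (Any; here; there; any?)
import Data.List.Relation.Unary.Any.Properties as Any
open import Data.Maybe using (Maybe; just; nothing)
import Data.Maybe.Properties as Maybe
open import Data.Nat as ℕ using (zero; suc; z≤n; s≤s; z<s; s<s)
import Data.Nat.Properties as ℕ
open import Data.Product using (_×_; _,_; proj₁; proj₂; ∃; ∃₂; swap)
import Data.Product.Properties as Product
open import Data.Sum using (_⊎_; inj₁; inj₂)
open import Data.Vec as Vec using (Vec; []; _∷_; lookup; _[_]%=_)
import Data.Vec.Properties as Vec
open import Function using (_∘_; _$_)
open import Relation.Binary.Definitions using (DecidableEquality)
open import Relation.Binary.PropositionalEquality using (_≡_; _≢_; refl; sym; trans; cong; cong₂; subst; subst₂; module ≡-Reasoning)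
open import Relation.Nullary using (Dec; yes; no; ¬_; does; contradiction)
open import Relation.Nullary.Decidable using (toWitness; _×-dec_; _⊎-dec_; ¬?)

open import Algebra.Properties.Group (AbelianGroup.group ℤ.+-0-abelianGroup) using (∙-cancelʳ)
open +-*-Solver using (Polynomial; solve; _:+_; _:*_; _:-_; :-_; _:=_; con)

-- Linear forms

-- A form of length 4 is evaluated at (1 , A , B , C); forms of length 5 and 6 have
-- one or two further variables, the indices along ribbons, in front.

Form : ℕ → Set
Form = Vec ℤ

⟦_⟧ : ∀ {n} → Form n → Vec ℤ n → ℤ
⟦ [] ⟧ [] = 0ℤ
⟦ c ∷ f ⟧ (x ∷ ρ) = c * x + ⟦ f ⟧ ρ

infixl 6 _⊕_ _⊝_
infixl 7 _⊙_

_⊕_ : ∀ {n} → Form n → Form n → Form n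
_⊕_ = Vec.zipWith _+_

_⊙_ : ∀ {n} → ℤ → Form n → Form n
c ⊙ f = Vec.map (c *_) f

_⊝_ : ∀ {n} → Form n → Form n → Form n
f ⊝ g = f ⊕ -1ℤ ⊙ g

𝟎 : ∀ {n} → Form n
𝟎 = Vec.replicate _ 0ℤ

_≟ᶠ_ : ∀ {n} → DecidableEquality (Form n)
_≟ᶠ_ = Vec.≡-dec ℤ._≟_

const : ℤ → Form 4
const c = c ∷ 0ℤ ∷ 0ℤ ∷ 0ℤ ∷ []

-- Nonnegativity for all A, B, C ≥ 1.
Nonnegative : Form 4 → Set
Nonnegative (c ∷ f) = All (0ℤ ℤ.≤_) (Vec.toList f) × 0ℤ ℤ.≤ Vec.foldr _ _+_ c f

nonnegative? : ∀ f → Dec (Nonnegative f)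
nonnegative? (c ∷ f) = all? (0ℤ ℤ.≤?_) (Vec.toList f) ×-dec (0ℤ ℤ.≤? Vec.foldr _ _+_ c f)

-- The minimum of c k + f over 0 ≤ k ≤ u.
lower : Form 4 → ℤ → Form 4 → Form 4
lower u c f = if does (0ℤ ℤ.≤? c) then f else f ⊕ c ⊙ u

-- The two indices become independent variables: the index of the second form comes first, that of
-- the first form second.
difference : Form 5 → Form 5 → Form 6
difference (c ∷ f) (d ∷ g) = - d ∷ c ∷ (f ⊝ g)

lower₂ : Form 4 → Form 4 → Form 6 → Form 4
lower₂ u v (d ∷ c ∷ f) = lower u c (lower v d f)

-- The constant term is the third coefficient.
Indivisible : ℤ → Form 6 → Set
Indivisible m (d ∷ c ∷ e ∷ f) = All (m ∣_) (d ∷ c ∷ Vec.toList f) × ¬ (m ∣ e)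

indivisible? : ∀ m f → Dec (Indivisible m f)
indivisible? m (d ∷ c ∷ e ∷ f) = all? (m ∣?_) (d ∷ c ∷ Vec.toList f) ×-dec ¬? (m ∣? e)

-- A parity obstruction, a positive lower bound over the rectangle of indices, or an obstruction
-- modulo 4: each excludes the value zero.
Nonvanishing : Form 4 → Form 4 → Form 6 → Set
Nonvanishing u v f =
  Indivisible (+ 2) f ⊎ Nonnegative (lower₂ u v f ⊝ const 1ℤ) ⊎ Indivisible (+ 4) f

nonvanishing? : ∀ u v f → Dec (Nonvanishing u v f)
nonvanishing? u v f =
  indivisible? (+ 2) f ⊎-dec nonnegative? (lower₂ u v f ⊝ const 1ℤ) ⊎-dec indivisible? (+ 4) f

combine : ∀ {n} → List ℤ → List (Form n) → Form n
combine (c ∷ cs) (f ∷ fs) = c ⊙ f ⊕ combine cs fs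
combine _ _ = 𝟎

-- At a common zero of the forms every integer combination would vanish, so one nonvanishing
-- combination excludes it. `Λ` lists the coefficient vectors to try.
Separated : List (List ℤ) → Form 4 → Form 4 → List (Form 6) → Set
Separated Λ u v fs = Any (λ cs → Nonvanishing u v (combine cs fs)) Λ

separated? : ∀ Λ u v fs → Dec (Separated Λ u v fs)
separated? Λ u v fs = any? (λ cs → nonvanishing? u v (combine cs fs)) Λ

-- Junctions and vertex families

-- Vertices of a cube whose three axes are the directions of the chains of a, b
-- and c hexagons; the vertex (false , true , true) does not occur.  Z is the centre
-- of the starphene and Q₁₂, Q₂₃, Q₃₁ are the corners of the coronoid without arm.
Junction : Set
Junction = Vec Bool 3

Axis : Set
Axis = Fin 3

pattern P₁  = false ∷ false ∷ false ∷ []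
pattern Z   = true  ∷ false ∷ false ∷ []
pattern Q₁₂ = false ∷ true  ∷ false ∷ []
pattern Q₃₁ = false ∷ false ∷ true  ∷ []
pattern P₂  = true  ∷ true  ∷ false ∷ []
pattern P₃  = true  ∷ false ∷ true  ∷ []
pattern Q₂₃ = true  ∷ true  ∷ true  ∷ []

pattern 𝕒 = zero
pattern 𝕓 = suc zero
pattern 𝕔 = suc (suc zero)

flip : Axis → Junction → Junction
flip ℓ J = J [ ℓ ]%= not

len : Axis → Form 4
len 𝕒 = 0ℤ ∷ 1ℤ ∷ 0ℤ ∷ 0ℤ ∷ []
len 𝕓 = 0ℤ ∷ 0ℤ ∷ 1ℤ ∷ 0ℤ ∷ []
len 𝕔 = 0ℤ ∷ 0ℤ ∷ 0ℤ ∷ 1ℤ ∷ []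

bit : Bool → ℤ
bit b = if b then 1ℤ else 0ℤ

sgn : Bool → ℤ
sgn b = if b then -1ℤ else 1ℤ

-- e1, e2 and -e3 in brick-wall coordinates.
unit : Axis → ℤ × ℤ
unit 𝕒 = + 2 , 0ℤ
unit 𝕓 = 1ℤ , 1ℤ
unit 𝕔 = 1ℤ , -1ℤ

-- A ribbon leaves a hub (Z or Qᵢⱼ) and ends at a cluster Pᵢ.  Counted from the
-- hub, rung number k (0 ≤ k ≤ n) is a transversal edge, and mid number k (k < n)
-- is the vertex between rungs k and k + 1 on one side.
Motion : Set
Motion = Maybe (Axis × Bool)

pattern still  = nothing
pattern rung ℓ = just (ℓ , false)
pattern mid ℓ  = just (ℓ , true)

-- The vertices  origin + (displacement of the junction) + k * speed;  core is the
-- position of the vertex of the core onto which they all contract.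
record Family : Set where
  constructor family
  field
    junction : Junction
    motion   : Motion
    core     : Vtx
    origin   : Vtx
open Family

_≟ᵛ_ : DecidableEquality Vtx
_≟ᵛ_ = Product.≡-dec ℤ._≟_ ℤ._≟_

_≟ᴶ_ : DecidableEquality Junction
_≟ᴶ_ = Vec.≡-dec Bool._≟_

_≟ᴹ_ : DecidableEquality Motion
_≟ᴹ_ = Maybe.≡-dec (Product.≡-dec Fin._≟_ Bool._≟_)

_≟ᶠᵃᵐ_ : DecidableEquality Family
family J m v w ≟ᶠᵃᵐ family J′ m′ v′ w′
  with J ≟ᴶ J′ | m ≟ᴹ m′ | v ≟ᵛ v′ | w ≟ᵛ w′
... | yes refl | yes refl | yes refl | yes refl = yes refl
... | no p | _ | _ | _ = no λ where refl → p refl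
... | _ | no p | _ | _ = no λ where refl → p refl
... | _ | _ | no p | _ = no λ where refl → p refl
... | _ | _ | _ | no p = no λ where refl → p refl

open DecMembership _≟ᶠᵃᵐ_ using (_∈?_)

bound : Family → Form 4
bound f with motion f
... | still  = 𝟎
... | rung ℓ = len ℓ
... | mid ℓ  = len ℓ ⊝ const 1ℤ

-- Each bit that is on adds the ribbon length of its axis times `unit`. The normalisation keeps
-- `Q₃₁`, where the first chain of the coronoid starts, at its core position.
shiftX shiftY : Junction → Form 4
shiftX (p ∷ q ∷ r ∷ []) = 0ℤ ∷ + 2 * bit p ∷ bit q ∷ bit r - 1ℤ ∷ []
shiftY (p ∷ q ∷ r ∷ []) = 0ℤ ∷ 0ℤ ∷ bit q ∷ 1ℤ - bit r ∷ []

-- A ribbon flips the bit of its axis, so it runs along `unit` if this bit is off at the hub and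
-- against it if it is on.
speed : Junction → Motion → ℤ × ℤ
speed J still = 0ℤ , 0ℤ
speed J (just (ℓ , _)) = sgn (lookup J ℓ) * proj₁ (unit ℓ) , sgn (lookup J ℓ) * proj₂ (unit ℓ)

locX locY : Family → Form 5
locX f = proj₁ (speed (junction f) (motion f)) ∷ (const (proj₁ (origin f)) ⊕ shiftX (junction f))
locY f = proj₂ (speed (junction f) (motion f)) ∷ (const (proj₂ (origin f)) ⊕ shiftY (junction f))

parity : Vtx → ℤ
parity (x , y) = + ((x + y) %ℕ 2)

-- Vertical steps alternate with horizontal ones; turn corrects for the direction
-- of the vertical edges at the two ends.
lattice : Vtx → Vtx → ℤ
lattice v@(x , y) w@(x′ , y′) = dy + ((+ ∣ x - x′ ∣) ⊔ (dy + turn))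
  where
  dy = + ∣ y - y′ ∣
  turn = if does (y ℤ.≤? y′) then parity v - parity w else parity w - parity v

-- Traversing a ribbon costs two steps per hexagon, so each axis on which the junctions differ
-- contributes twice its length. Along a ribbon the value rises with the index if the hub agrees
-- with `P` on that axis and falls otherwise; a mid vertex lies one step past its rung.
stretch : Junction → Family → Form 5
stretch P f = go (motion f)
  where
  J = junction f
  offset : Form 4
  offset = 0ℤ ∷ Vec.zipWith (λ p q → + 2 * bit (p xor q)) P J
  away : Axis → ℤ
  away ℓ = sgn (lookup P ℓ xor lookup J ℓ)
  go : Motion → Form 5
  go still    = 0ℤ ∷ offset
  go (rung ℓ) = + 2 * away ℓ ∷ offset
  go (mid ℓ)  = + 2 * away ℓ ∷ (offset ⊕ const (away ℓ))

dist : Junction × Vtx → Family → Form 5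
dist (P , v) f = (0ℤ ∷ const (lattice v (core f))) ⊕ stretch P f

-- t and b are the ends of rung 0, and p and q their successors along the ribbon.
record Ribbon : Set where
  constructor ribbon
  field
    hub     : Junction
    axis    : Axis
    t b p q : Vtx

fixed : Junction → List Vtx → List Family
fixed J = map (λ v → family J still v v)

-- Spokes lie in the arms of the starphene, rims in the sides of the coronoid. The coordinates are
-- those of the core.
spokes rims : List Ribbon
spokes =
  ribbon Z   𝕒 (+ 2 , + 2) (+ 2 , + 3) (+ 1 , + 2) (+ 1 , + 3) ∷
  ribbon Z   𝕓 (+ 3 , + 3) (+ 4 , + 3) (+ 3 , + 4) (+ 5 , + 3) ∷
  ribbon Z   𝕔 (+ 4 , + 2) (+ 3 , + 2) (+ 5 , + 2) (+ 3 , + 1) ∷ []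
rims =
  ribbon Q₁₂ 𝕓 (+ 1 , + 4) (+ 0 , + 4) (+ 1 , + 3) (- + 1 , + 4) ∷
  ribbon Q₁₂ 𝕒 (+ 2 , + 5) (+ 2 , + 4) (+ 3 , + 5) (+ 3 , + 4) ∷
  ribbon Q₂₃ 𝕔 (+ 6 , + 3) (+ 7 , + 3) (+ 5 , + 3) (+ 7 , + 4) ∷
  ribbon Q₂₃ 𝕓 (+ 7 , + 2) (+ 6 , + 2) (+ 7 , + 1) (+ 5 , + 2) ∷
  ribbon Q₃₁ 𝕒 (+ 2 , + 1) (+ 2 , + 0) (+ 3 , + 1) (+ 3 , + 0) ∷
  ribbon Q₃₁ 𝕔 (+ 0 , + 1) (+ 1 , + 1) (- + 1 , + 1) (+ 1 , + 2) ∷ []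

ribbons : List Ribbon
ribbons = spokes ++ rims

tF bF pF qF : Ribbon → Family
tF (ribbon J ℓ t b p q) = family J (rung ℓ) t t
bF (ribbon J ℓ t b p q) = family J (rung ℓ) b b
pF (ribbon J ℓ t b p q) = family J (mid ℓ) t p
qF (ribbon J ℓ t b p q) = family J (mid ℓ) b q

ribbonFamilies : List Family
ribbonFamilies = concatMap (λ r → tF r ∷ bF r ∷ pF r ∷ qF r ∷ []) ribbons

stillFamilies : List Family
stillFamilies =
  fixed Q₁₂ ((+ 0 , + 5) ∷ (+ 1 , + 5) ∷ []) ++
  fixed Q₂₃ ((+ 8 , + 3) ∷ (+ 8 , + 2) ∷ []) ++
  fixed Q₃₁ ((+ 1 , + 0) ∷ (+ 0 , + 0) ∷ []) ++
  fixed P₁ ((+ 0 , + 2) ∷ (+ 0 , + 3) ∷ (- + 1 , + 3) ∷ (- + 2 , + 3) ∷ (- + 2 , + 2) ∷ (- + 1 , + 2) ∷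
            (+ 1 , + 3) ∷ (+ 1 , + 2) ∷ (- + 1 , + 4) ∷ (- + 1 , + 1) ∷ []) ++
  fixed P₂ ((+ 4 , + 4) ∷ (+ 5 , + 4) ∷ (+ 6 , + 4) ∷ (+ 6 , + 5) ∷ (+ 5 , + 5) ∷ (+ 4 , + 5) ∷
            (+ 5 , + 3) ∷ (+ 3 , + 4) ∷ (+ 7 , + 4) ∷ (+ 3 , + 5) ∷ []) ++
  fixed P₃ ((+ 5 , + 1) ∷ (+ 4 , + 1) ∷ (+ 4 , + 0) ∷ (+ 5 , + 0) ∷ (+ 6 , + 0) ∷ (+ 6 , + 1) ∷
            (+ 3 , + 1) ∷ (+ 5 , + 2) ∷ (+ 3 , + 0) ∷ (+ 7 , + 1) ∷ [])

opaque
  families : List Family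
  families = ribbonFamilies ++ stillFamilies

Apart : Family → Family → Set
Apart f g = Separated
  ((1ℤ ∷ 1ℤ ∷ []) ∷ (1ℤ ∷ 0ℤ ∷ []) ∷ (-1ℤ ∷ 0ℤ ∷ []) ∷ (0ℤ ∷ 1ℤ ∷ []) ∷ (0ℤ ∷ -1ℤ ∷ []) ∷
   (-1ℤ ∷ -1ℤ ∷ []) ∷ (1ℤ ∷ -1ℤ ∷ []) ∷ (-1ℤ ∷ 1ℤ ∷ []) ∷ [])
  (bound f) (bound g) (difference (locX f) (locX g) ∷ difference (locY f) (locY g) ∷ [])

apart? : ∀ f g → Dec (Apart f g)
apart? f g = separated? _ _ _ _

opaque
  unfolding families
  -- Ensures that a function defined family by family is well defined on vertices.
  families-apart : AllPairs Apart families
  families-apart = toWitness {a? = allPairs? apart? families} _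

-- Edge families

this next : Form 5
this = 1ℤ ∷ 𝟎
next = 1ℤ ∷ const 1ℤ

at : Form 4 → Form 5
at f = 0ℤ ∷ f

-- Composition of affine functions of the index.
sub : Form 5 → Form 5 → Form 5
sub (c ∷ f) ι = c ⊙ ι ⊕ at f

Within : Form 4 → Form 5 → Set
Within u (c ∷ f) = Nonnegative (lower u c f)

within? : ∀ u f → Dec (Within u f)
within? u (c ∷ f) = nonnegative? (lower u c f)

Inside : Form 4 → Form 4 → Form 5 → Set
Inside u v ι = Within u ι × Within u (at v ⊝ ι)

inside? : ∀ u v ι → Dec (Inside u v ι)
inside? u v ι = within? u ι ×-dec within? u (at v ⊝ ι)

record Point : Set where
  constructor point
  field
    fam : Family
    idx : Form 5
open Point

record EdgeFamily : Set where
  constructor edge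
  field
    end₁ end₂ : Point
    range     : Form 4
open EdgeFamily

ribbonEdges : Ribbon → List EdgeFamily
ribbonEdges r =
  edge (point (tF r) this) (point (bF r) this) n ∷
  edge (point (tF r) this) (point (pF r) this) n-1 ∷
  edge (point (pF r) this) (point (tF r) next) n-1 ∷
  edge (point (bF r) this) (point (qF r) this) n-1 ∷
  edge (point (qF r) this) (point (bF r) next) n-1 ∷ []
  where
  n = len (Ribbon.axis r)
  n-1 = n ⊝ const 1ℤ

pairs : {X : Set} → List X → List (X × X)
pairs [] = []
pairs (x ∷ xs) = map (x ,_) xs ++ pairs xs

-- A ribbon is attached to its hub at rung 0 and to its cluster at the last rung, hence the indices
-- 0 and `len`.
nodes : Junction → List Point
nodes J = map (λ f → point f 𝟎) (filter (λ f → junction f ≟ᴶ J) stillFamilies) ++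
  concatMap (λ r → point (tF r) 𝟎 ∷ point (bF r) 𝟎 ∷ [])
    (filter (λ r → Ribbon.hub r ≟ᴶ J) ribbons) ++
  concatMap (λ r → point (tF r) (at (len (Ribbon.axis r))) ∷ point (bF r) (at (len (Ribbon.axis r))) ∷ [])
    (filter (λ r → flip (Ribbon.axis r) (Ribbon.hub r) ≟ᴶ J) ribbons)

-- Edges within a junction are read off the core, which is isometric in the lattice, so adjacency
-- there is lattice distance 1.
adjacent? : (pq : Point × Point) → Dec (lattice (core (fam (proj₁ pq))) (core (fam (proj₂ pq))) ≡ 1ℤ)
adjacent? _ = _ ℤ.≟ _

-- Rungs are already listed with the ribbons; listing them again would put one edge into two
-- families, against `edges-resolved`.
SameRung : Point × Point → Set
SameRung (p , q) =
  motion (fam p) ≢ still × motion (fam p) ≡ motion (fam q) × junction (fam p) ≡ junction (fam q)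

sameRung? : ∀ pq → Dec (SameRung pq)
sameRung? (p , q) = ¬? (motion (fam p) ≟ᴹ still) ×-dec
  (motion (fam p) ≟ᴹ motion (fam q)) ×-dec (junction (fam p) ≟ᴶ junction (fam q))

junctionEdges : Junction → List EdgeFamily
junctionEdges J = map (λ (p , q) → edge p q 𝟎) (filter (¬? ∘ sameRung?) (filter adjacent? (pairs (nodes J))))

hubs clusters : List Junction
hubs = Z ∷ Q₁₂ ∷ Q₂₃ ∷ Q₃₁ ∷ []
clusters = P₁ ∷ P₂ ∷ P₃ ∷ []

opaque
  edgeFamilies : List EdgeFamily
  edgeFamilies = concatMap ribbonEdges ribbons ++ concatMap junctionEdges (hubs ++ clusters)

Valid : Form 4 → Point → Set
Valid u (point f ι) = f ∈ families × Inside u (bound f) ι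

valid? : ∀ u p → Dec (Valid u p)
valid? u (point f ι) = (f ∈? families) ×-dec inside? u (bound f) ι

opaque
  unfolding families edgeFamilies
  edges-valid : All (λ e → Valid (range e) (end₁ e) × Valid (range e) (end₂ e)) edgeFamilies
  edges-valid = toWitness
    {a? = all? (λ e → valid? (range e) (end₁ e) ×-dec valid? (range e) (end₂ e)) edgeFamilies} _

-- Symbolic distances from cluster vertices and their local checks

Base : Set
Base = Junction × Vtx

opaque
  bases : List Base
  bases = concatMap (λ P → map (λ p → P , core (fam p)) (nodes P)) clusters

distAt : Base → Point → Form 5
distAt x (point f ι) = sub (dist x f) ι

-- Requiring one constant difference along the whole family turns the check into an equality of
-- forms.
Lipschitz : Base → EdgeFamily → Set
Lipschitz x e = Any (λ c → distAt x (end₁ e) ⊝ distAt x (end₂ e) ≡ at (const c)) (-1ℤ ∷ 0ℤ ∷ 1ℤ ∷ [])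

lipschitz? : ∀ x e → Dec (Lipschitz x e)
lipschitz? x e = any? (λ c → (distAt x (end₁ e) ⊝ distAt x (end₂ e)) ≟ᶠ at (const c)) _

opaque
  unfolding edgeFamilies bases
  -- One half of the distance formula: no walk to the base is shorter than the value.
  dist-lipschitz : All (λ x → All (Lipschitz x) edgeFamilies) bases
  dist-lipschitz = toWitness {a? = all? (λ x → all? (lipschitz? x) edgeFamilies) bases} _

-- Ways to cover the index range [0 , u] by images of ranges, so that the first or
-- the last index can be treated apart from the others.
Part : Set
Part = Form 5 × Form 4

splits : Form 4 → List (List Part)
splits u = if does (u ≟ᶠ 𝟎) then ((𝟎 , 𝟎) ∷ []) ∷ [] else
  ((this , u) ∷ []) ∷
  ((𝟎 , 𝟎) ∷ (next , u ⊝ const 1ℤ) ∷ []) ∷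
  ((at u , 𝟎) ∷ (this , u ⊝ const 1ℤ) ∷ []) ∷ []

baseX baseY : Base → Form 4
baseX (P , (x , y)) = const x ⊕ shiftX P
baseY (P , (x , y)) = const y ⊕ shiftY P

IsBase : Base → Family → Form 5 → Set
IsBase x f ι = sub (locX f) ι ≡ at (baseX x) × sub (locY f) ι ≡ at (baseY x) × sub (dist x f) ι ≡ 𝟎

isBase? : ∀ x f ι → Dec (IsBase x f ι)
isBase? x f ι = (sub (locX f) ι ≟ᶠ _) ×-dec (sub (locY f) ι ≟ᶠ _) ×-dec (sub (dist x f) ι ≟ᶠ _)

record Dart : Set where
  constructor dart
  field
    source target : Point
    extent : Form 4
open Dart

darts : List Dart
darts = concatMap (λ (edge p q u) → dart p q u ∷ dart q p u ∷ []) edgeFamilies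

-- `η` selects the member of the dart that leaves the vertex with index `ι`.
Descends : Base → Family → Part → Dart → Set
Descends x f (ι , u) (dart (point g κ) q v) =
  Any (λ η → sub κ η ≡ ι × Inside u v η × sub (distAt x q) η ≡ sub (dist x f) ι ⊝ at (const 1ℤ))
    (this ∷ 𝟎 ∷ at v ∷ [])

descends? : ∀ x f p d → Dec (Descends x f p d)
descends? x f (ι , u) (dart (point g κ) q v) =
  any? (λ η → (sub κ η ≟ᶠ ι) ×-dec inside? u v η ×-dec (sub (distAt x q) η ≟ᶠ _)) _

-- Since the values are nonnegative, repeated descent must stop, and it can stop only at the base.
Reaches : List Dart → Base → Family → Set
Reaches ds x f = Within (bound f) (dist x f) ×
  Any (All (λ p → IsBase x f (proj₁ p) ⊎ Any (Descends x f p) ds)) (splits (bound f))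

reaches? : ∀ ds x f → Dec (Reaches ds x f)
reaches? ds x f = within? (bound f) (dist x f) ×-dec
  any? (all? (λ p → isBase? x f (proj₁ p) ⊎-dec any? (descends? x f p) ds)) (splits (bound f))

leaving : List Dart → Family → List Dart
leaving ds f = filter (λ d → fam (source d) ≟ᶠᵃᵐ f) ds

Reachable : Family → List Dart → Set
Reachable f ds = All (λ x → Reaches ds x f) bases

reachable? : ∀ f ds → Dec (Reachable f ds)
reachable? f ds = all? (λ x → reaches? ds x f) bases

families-reachable? : ∀ ds → Dec (All (λ f → Reachable f (leaving ds f)) families)
families-reachable? ds = all? (λ f → reachable? f (leaving ds f)) families

opaque
  unfolding families edgeFamilies bases
  -- The other half of the distance formula: following descents gives a walk whose length is the
  -- value.
  families-reachable : All (λ f → Reachable f (leaving darts f)) families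
  families-reachable = toWitness {a? = families-reachable? darts} _

-- Landmarks and the labels of edges

landmarks : List Base
landmarks = (P₁ , (+ 0 , + 2)) ∷ (P₂ , (+ 4 , + 4)) ∷ (P₃ , (+ 5 , + 1)) ∷ []

constant : Form 5 → ℤ
constant (_ ∷ c ∷ _) = c

-- The distances of the two ends differ by a constant, so the smaller one is a form.
edgeDist : Base → EdgeFamily → Form 5
edgeDist x e = if does (constant (distAt x (end₁ e) ⊝ distAt x (end₂ e)) ℤ.≤? 0ℤ)
  then distAt x (end₁ e) else distAt x (end₂ e)

record Labelled : Set where
  constructor labelled
  field
    span   : Form 4
    labels : List (Form 5)

zipDiff : List (Form 5) → List (Form 5) → List (Form 6)
zipDiff (f ∷ fs) (g ∷ gs) = difference f g ∷ zipDiff fs gs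
zipDiff _ _ = []

Resolved : Labelled → Labelled → Set
Resolved (labelled u fs) (labelled v gs) = Separated
  ((0ℤ ∷ 0ℤ ∷ 1ℤ ∷ []) ∷ (0ℤ ∷ 0ℤ ∷ -1ℤ ∷ []) ∷ (0ℤ ∷ 1ℤ ∷ 0ℤ ∷ []) ∷ (0ℤ ∷ -1ℤ ∷ 0ℤ ∷ []) ∷
   (1ℤ ∷ 0ℤ ∷ 0ℤ ∷ []) ∷ (-1ℤ ∷ 0ℤ ∷ 0ℤ ∷ []) ∷
   (0ℤ ∷ 1ℤ ∷ 1ℤ ∷ []) ∷ (0ℤ ∷ -1ℤ ∷ 1ℤ ∷ []) ∷ (0ℤ ∷ 1ℤ ∷ -1ℤ ∷ []) ∷ (0ℤ ∷ -1ℤ ∷ -1ℤ ∷ []) ∷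
   (1ℤ ∷ 0ℤ ∷ 1ℤ ∷ []) ∷ (-1ℤ ∷ 0ℤ ∷ 1ℤ ∷ []) ∷ (1ℤ ∷ 0ℤ ∷ -1ℤ ∷ []) ∷ (-1ℤ ∷ 0ℤ ∷ -1ℤ ∷ []) ∷ [])
  u v (zipDiff fs gs)

resolved? : ∀ e e′ → Dec (Resolved e e′)
resolved? e e′ = separated? _ _ _ _

label : EdgeFamily → Labelled
label e = labelled (range e) (map (λ x → edgeDist x e) landmarks)

opaque
  unfolding edgeFamilies
  -- This compares different families; two members of one family are settled by `edges-rigid`.
  edges-resolved : AllPairs Resolved (map label edgeFamilies)
  edges-resolved = toWitness {a? = allPairs? resolved? (map label edgeFamilies)} _

-- Hexagons of the graph

record Cell : Set where
  constructor cell
  field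
    cu cv  : Form 5
    crange : Form 4
open Cell

-- Axial coordinates of the corner hexagon at a junction. Along an axis, neighbouring corners are
-- two hexagons apart in the core and a ribbon length further in general.
cornerU cornerV : Junction → Form 4
cornerU (p ∷ q ∷ r ∷ []) = + 2 * (bit p + bit r - 1ℤ) ∷ bit p ∷ 0ℤ ∷ bit r - 1ℤ ∷ []
cornerV (p ∷ q ∷ r ∷ []) = + 2 * (bit q - bit r + 1ℤ) ∷ 0ℤ ∷ bit q ∷ 1ℤ - bit r ∷ []

hexUnit : Axis → ℤ × ℤ
hexUnit 𝕒 = 1ℤ , 0ℤ
hexUnit 𝕓 = 0ℤ , 1ℤ
hexUnit 𝕔 = 1ℤ , -1ℤ

hexSpeed : Junction → Axis → ℤ × ℤ
hexSpeed J ℓ = sgn (lookup J ℓ) * proj₁ (hexUnit ℓ) , sgn (lookup J ℓ) * proj₂ (hexUnit ℓ)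

hexPath : Ribbon → Form 5 × Form 5
hexPath r = (proj₁ (hexSpeed J ℓ) ∷ cornerU J) , (proj₂ (hexSpeed J ℓ) ∷ cornerV J)
  where J = Ribbon.hub r
        ℓ = Ribbon.axis r

cellOf : Ribbon → Form 5 → Form 4 → Cell
cellOf r ι u = cell (sub (proj₁ (hexPath r)) ι) (sub (proj₂ (hexPath r)) ι) u

-- With n the ribbon length and counting from the hub, hexagon 0 precedes rung 0, hexagons 1 to n
-- lie between consecutive rungs, and hexagon n + 1 follows the last rung. A side of the coronoid
-- has one more, its corner at the cluster.
spokeCells rimCells : Ribbon → List Cell
spokeCells r@(ribbon _ ℓ _ _ _ _) =
  cellOf r 𝟎 𝟎 ∷ cellOf r next (len ℓ ⊝ const 1ℤ) ∷ cellOf r (at (len ℓ ⊕ const 1ℤ)) 𝟎 ∷ []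
rimCells r@(ribbon _ ℓ _ _ _ _) = cellOf r (at (len ℓ ⊕ const (+ 2))) 𝟎 ∷ spokeCells r

opaque
  cells : List Cell
  cells = concatMap spokeCells spokes ++ concatMap rimCells rims

Spot : Set
Spot = Form 5 × Form 5

spots : Cell → List (Spot × Spot)
spots (cell u v _) =
  (at₂ 0ℤ 0ℤ , at₂ 1ℤ 0ℤ) ∷ (at₂ 1ℤ 0ℤ , at₂ (+ 2) 0ℤ) ∷ (at₂ 0ℤ 1ℤ , at₂ 1ℤ 1ℤ) ∷ (at₂ 1ℤ 1ℤ , at₂ (+ 2) 1ℤ) ∷
  (at₂ 0ℤ 0ℤ , at₂ 0ℤ 1ℤ) ∷ (at₂ (+ 2) 0ℤ , at₂ (+ 2) 1ℤ) ∷ []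
  where
  at₂ : ℤ → ℤ → Spot
  at₂ x y = (+ 2 ⊙ u ⊕ v ⊕ at (const x)) , (v ⊕ at (const y))

_≟ˢ_ : (s t : Spot × Spot) → Dec (s ≡ t)
_≟ˢ_ = Product.≡-dec (Product.≡-dec _≟ᶠ_ _≟ᶠ_) (Product.≡-dec _≟ᶠ_ _≟ᶠ_)

spot : Point → Spot
spot (point f ι) = sub (locX f) ι , sub (locY f) ι

subˢ : Spot → Form 5 → Spot
subˢ (x , y) η = sub x η , sub y η

Realises : Form 4 → Spot × Spot → EdgeFamily → Set
Realises u s e = Any (λ η →
  (s ≡ (subˢ (spot (end₁ e)) η , subˢ (spot (end₂ e)) η) ⊎
   s ≡ (subˢ (spot (end₂ e)) η , subˢ (spot (end₁ e)) η)) × Inside u (range e) η)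
  (this ∷ next ∷ 𝟎 ∷ at (range e) ∷ [])

realises? : ∀ u s e → Dec (Realises u s e)
realises? u s e = any? (λ η → ((s ≟ˢ _) ⊎-dec (s ≟ˢ _)) ×-dec inside? u (range e) η) _

opaque
  unfolding cells edgeFamilies
  -- Together with `edges-present`, the converse inclusion, this identifies the edges of the graph
  -- with the members of the edge families.
  cells-covered : All (λ c → All (λ s → Any (Realises (crange c) s) edgeFamilies) (spots c)) cells
  cells-covered = toWitness
    {a? = all? (λ c → all? (λ s → any? (realises? (crange c) s) edgeFamilies) (spots c)) cells} _

Present : EdgeFamily → Part → Set
Present e (η , u) = Any (λ c → crange c ≡ u ×
  Any (λ s → s ≡ (subˢ (spot (end₁ e)) η , subˢ (spot (end₂ e)) η) ⊎
             s ≡ (subˢ (spot (end₂ e)) η , subˢ (spot (end₁ e)) η)) (spots c)) cells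

present? : ∀ e p → Dec (Present e p)
present? e (η , u) = any? (λ c → (crange c ≟ᶠ u) ×-dec any? (λ s → (s ≟ˢ _) ⊎-dec (s ≟ˢ _)) (spots c)) cells

opaque
  unfolding cells edgeFamilies
  edges-present : All (λ e → Any (All (Present e)) (splits (range e))) edgeFamilies
  edges-present = toWitness
    {a? = all? (λ e → any? (all? (present? e)) (splits (range e))) edgeFamilies} _

-- Bonds: the edges of the clusters

_≟ᴮ_ : DecidableEquality Base
_≟ᴮ_ = Product.≡-dec _≟ᴶ_ _≟ᵛ_

open DecMembership _≟ᴮ_ using () renaming (_∈?_ to _∈ᴮ?_)

Bond : Set
Bond = Vtx × Vtx

_≟ᵇ_ : DecidableEquality Bond
_≟ᵇ_ = Product.≡-dec _≟ᵛ_ _≟ᵛ_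

opaque
  bonds : Junction → List Bond
  bonds P = map (λ (p , q) → core (fam p) , core (fam q)) (filter adjacent? (pairs (nodes P)))

BondPair : Set
BondPair = Junction × Bond × Bond

bondPairs : List BondPair
bondPairs = concatMap (λ P → map (P ,_) (pairs (bonds P))) clusters

fromBond : Bond → Vtx → ℤ
fromBond (x , y) v = lattice x v ⊓ lattice y v

Tie : Vtx → BondPair → Set
Tie v (_ , d , e) = fromBond d v ≡ fromBond e v

tie? : ∀ v p → Dec (Tie v p)
tie? v (_ , d , e) = fromBond d v ℤ.≟ fromBond e v

CommonTies : List BondPair → List Vtx → Set
CommonTies ps vs = All (λ w → Any (Tie w) ps) vs

commonTies? : ∀ ps vs → Dec (CommonTies ps vs)
commonTies? ps vs = all? (λ w → any? (tie? w) ps) vs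

cores : List Vtx
cores = map core families

allCommonTies? : ∀ ps vs → Dec (All (λ v → CommonTies (filter (tie? v) ps) vs) vs)
allCommonTies? ps vs = all? (λ v → commonTies? (filter (tie? v) ps) vs) vs

opaque
  unfolding families bonds
  -- A finite check over core positions suffices, because ribbon lengths and indices shift the
  -- distances to all bonds of one cluster equally.
  common-ties : All (λ v → CommonTies (filter (tie? v) bondPairs) cores) cores
  common-ties = toWitness {a? = allCommonTies? bondPairs cores} _

baseSpot : Base → Spot
baseSpot x = at (baseX x) , at (baseY x)

Bonded : Junction → Bond → Set
Bonded P (v , w) = (P , v) ∈ bases × (P , w) ∈ bases ×
  Any (Realises 𝟎 (baseSpot (P , v) , baseSpot (P , w))) edgeFamilies

bonded? : ∀ P d → Dec (Bonded P d)
bonded? P (v , w) = ((P , v) ∈ᴮ? bases) ×-dec ((P , w) ∈ᴮ? bases) ×-dec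
  any? (realises? 𝟎 (baseSpot (P , v) , baseSpot (P , w))) edgeFamilies

opaque
  unfolding bonds edgeFamilies bases
  bonds-bonded : All (λ P → All (Bonded P) (bonds P)) clusters
  bonds-bonded = toWitness {a? = all? (λ P → all? (bonded? P) (bonds P)) clusters} _

Distinct : Bond × Bond → Set
Distinct (d , e) = d ≢ e × d ≢ swap e

distinct? : ∀ p → Dec (Distinct p)
distinct? (d , e) = ¬? (d ≟ᵇ e) ×-dec ¬? (d ≟ᵇ swap e)

opaque
  unfolding bonds
  bonds-distinct : All (λ P → All Distinct (pairs (bonds P))) clusters
  bonds-distinct = toWitness {a? = all? (λ P → all? distinct? (pairs (bonds P))) clusters} _

-- Positions of the bases and injectivity within families

Locates : Base → Dart → Set
Locates x d = Any (λ η → Inside 𝟎 (extent d) η × subˢ (spot (source d)) η ≡ baseSpot x ×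
  sub (distAt x (source d)) η ≡ 𝟎) (𝟎 ∷ at (extent d) ∷ [])

locates? : ∀ x d → Dec (Locates x d)
locates? x d = any? (λ η → inside? 𝟎 (extent d) η ×-dec
  Product.≡-dec _≟ᶠ_ _≟ᶠ_ (subˢ (spot (source d)) η) (baseSpot x) ×-dec
  (sub (distAt x (source d)) η ≟ᶠ 𝟎)) _

opaque
  unfolding bases edgeFamilies
  -- A dart is used because its adjacency also shows that the base is a vertex of the graph.
  bases-located : All (λ x → Any (Locates x) darts) bases
  bases-located = toWitness {a? = all? (λ x → any? (locates? x) darts) bases} _

opaque
  unfolding families
  -- Every ribbon direction has a horizontal component, so the abscissa tells the members of one
  -- family apart.
  families-rigid : All (λ f → bound f ≡ 𝟎 ⊎ Vec.head (locX f) ≢ 0ℤ) families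
  families-rigid = toWitness
    {a? = all? (λ f → (bound f ≟ᶠ 𝟎) ⊎-dec ¬? (Vec.head (locX f) ℤ.≟ 0ℤ)) families} _

opaque
  unfolding edgeFamilies
  -- In a family with more than one member some landmark distance varies with the index and hence
  -- determines it.
  edges-rigid : All (λ e → range e ≡ 𝟎 ⊎ Any (λ x → Vec.head (edgeDist x e) ≢ 0ℤ) landmarks) edgeFamilies
  edges-rigid = toWitness {a? = all? (λ e → (range e ≟ᶠ 𝟎) ⊎-dec
    any? (λ x → ¬? (Vec.head (edgeDist x e) ℤ.≟ 0ℤ)) landmarks) edgeFamilies} _

opaque
  unfolding bases
  landmarks-bases : All (_∈ bases) landmarks
  landmarks-bases = toWitness {a? = all? (_∈ᴮ? bases) landmarks} _

Elsewhere : Base → Base → Set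
Elsewhere x y = Separated ((1ℤ ∷ 0ℤ ∷ []) ∷ (-1ℤ ∷ 0ℤ ∷ []) ∷ (0ℤ ∷ 1ℤ ∷ []) ∷ (0ℤ ∷ -1ℤ ∷ []) ∷ []) 𝟎 𝟎
  (difference (at (baseX x)) (at (baseX y)) ∷ difference (at (baseY x)) (at (baseY y)) ∷ [])

opaque
  landmarks-elsewhere : AllPairs Elsewhere landmarks
  landmarks-elsewhere = toWitness {a? = allPairs? (λ x y → separated? _ _ _ _) landmarks} _

-- Evaluation of forms

⟦⊕⟧ : ∀ {n} (f g : Form n) σ → ⟦ f ⊕ g ⟧ σ ≡ ⟦ f ⟧ σ + ⟦ g ⟧ σ
⟦⊕⟧ [] [] [] = refl
⟦⊕⟧ (c ∷ f) (d ∷ g) (x ∷ σ) rewrite ⟦⊕⟧ f g σ =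
  solve 5 (λ c d x F G → (c :+ d) :* x :+ (F :+ G) := (c :* x :+ F) :+ (d :* x :+ G)) refl
    c d x (⟦ f ⟧ σ) (⟦ g ⟧ σ)

⟦⊙⟧ : ∀ {n} c (f : Form n) σ → ⟦ c ⊙ f ⟧ σ ≡ c * ⟦ f ⟧ σ
⟦⊙⟧ c [] [] = sym (ℤ.*-zeroʳ c)
⟦⊙⟧ c (d ∷ f) (x ∷ σ) rewrite ⟦⊙⟧ c f σ =
  solve 4 (λ c d x F → (c :* d) :* x :+ c :* F := c :* (d :* x :+ F)) refl c d x (⟦ f ⟧ σ)

⟦⊝⟧ : ∀ {n} (f g : Form n) σ → ⟦ f ⊝ g ⟧ σ ≡ ⟦ f ⟧ σ - ⟦ g ⟧ σ
⟦⊝⟧ f g σ = trans (⟦⊕⟧ f _ σ) (cong (λ z → ⟦ f ⟧ σ + z) (trans (⟦⊙⟧ -1ℤ g σ) (ℤ.-1*i≡-i _)))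

⟦𝟎⟧ : ∀ {n} (σ : Vec ℤ n) → ⟦ 𝟎 ⟧ σ ≡ 0ℤ
⟦𝟎⟧ [] = refl
⟦𝟎⟧ (x ∷ σ) = trans (ℤ.+-identityˡ _) (⟦𝟎⟧ σ)

module Eval (ρ : Vec ℤ 4) where

  val : Form 5 → ℤ → ℤ
  val f k = ⟦ f ⟧ (k ∷ ρ)

  val-at : ∀ f k → val (at f) k ≡ ⟦ f ⟧ ρ
  val-at f k = ℤ.+-identityˡ _

  val-this : ∀ k → val this k ≡ k
  val-this k = trans (cong₂ _+_ (ℤ.*-identityˡ k) (⟦𝟎⟧ ρ)) (ℤ.+-identityʳ k)

  val-sub : ∀ f ι k → val (sub f ι) k ≡ val f (val ι k)
  val-sub (c ∷ f) ι k =
    trans (⟦⊕⟧ (c ⊙ ι) (at f) (k ∷ ρ)) (cong₂ _+_ (⟦⊙⟧ c ι (k ∷ ρ)) (val-at f k))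

  ⟦difference⟧ : ∀ f g k j → ⟦ difference f g ⟧ (j ∷ k ∷ ρ) ≡ val f k - val g j
  ⟦difference⟧ (c ∷ f) (d ∷ g) k j rewrite ⟦⊝⟧ f g ρ =
    solve 6 (λ c d k j F G → (:- d) :* j :+ (c :* k :+ (F :- G)) := (c :* k :+ F) :- (d :* j :+ G)) refl
      c d k j (⟦ f ⟧ ρ) (⟦ g ⟧ ρ)

  InRange : Form 4 → ℤ → Set
  InRange u k = 0ℤ ℤ.≤ k × k ℤ.≤ ⟦ u ⟧ ρ

  lower-≤ : ∀ u c f {k} → InRange u k → ⟦ lower u c f ⟧ ρ ℤ.≤ c * k + ⟦ f ⟧ ρ
  lower-≤ u c@(+ i) f {k} (0≤k , _) = begin
    ⟦ f ⟧ ρ          ≡⟨ ℤ.+-identityˡ _ ⟨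
    0ℤ + ⟦ f ⟧ ρ     ≤⟨ ℤ.+-monoˡ-≤ (⟦ f ⟧ ρ) (subst (ℤ._≤ c * k) (ℤ.*-zeroʳ c) (ℤ.*-monoˡ-≤-nonNeg c 0≤k)) ⟩
    c * k + ⟦ f ⟧ ρ  ∎
    where open ℤ.≤-Reasoning
  lower-≤ u c@(-[1+ i ]) f {k} (_ , k≤u) = begin
    ⟦ f ⊕ c ⊙ u ⟧ ρ        ≡⟨ trans (⟦⊕⟧ f (c ⊙ u) ρ) (cong (λ z → ⟦ f ⟧ ρ + z) (⟦⊙⟧ c u ρ)) ⟩
    ⟦ f ⟧ ρ + c * ⟦ u ⟧ ρ  ≤⟨ ℤ.+-monoʳ-≤ (⟦ f ⟧ ρ) (ℤ.*-monoˡ-≤-nonPos c k≤u) ⟩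
    ⟦ f ⟧ ρ + c * k        ≡⟨ ℤ.+-comm (⟦ f ⟧ ρ) _ ⟩
    c * k + ⟦ f ⟧ ρ        ∎
    where open ℤ.≤-Reasoning

module Box (l m n : ℕ) where

  ρ : Vec ℤ 4
  ρ = 1ℤ ∷ + suc l ∷ + suc m ∷ + suc n ∷ []

  open Eval ρ public

  ⟦const⟧ : ∀ c → ⟦ const c ⟧ ρ ≡ c
  ⟦const⟧ c = trans (cong₂ _+_ (ℤ.*-identityʳ c) (ℤ.+-identityˡ 0ℤ)) (ℤ.+-identityʳ c)

  ⟦pred⟧ : ∀ u → ⟦ u ⊝ const 1ℤ ⟧ ρ ≡ ⟦ u ⟧ ρ - 1ℤ
  ⟦pred⟧ u = trans (⟦⊝⟧ u (const 1ℤ) ρ) (cong (λ z → ⟦ u ⟧ ρ - z) (⟦const⟧ 1ℤ))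

  -- Applied to each parameter, a successor, this bounds a form from below by the sum of its
  -- coefficients.
  coefficient-≤ : ∀ {c} k → 0ℤ ℤ.≤ c → c ℤ.≤ c * + suc k
  coefficient-≤ {+ i} k _ =
    subst (ℤ._≤ + i * + suc k) (ℤ.*-identityʳ (+ i)) (ℤ.*-monoˡ-≤-nonNeg (+ i) (+≤+ (s≤s z≤n)))

  nonnegative-sound : ∀ f → Nonnegative f → 0ℤ ℤ.≤ ⟦ f ⟧ ρ
  nonnegative-sound (c ∷ x ∷ y ∷ z ∷ []) (0≤x ∷ 0≤y ∷ 0≤z ∷ [] , 0≤Σ) = begin
    0ℤ                    ≤⟨ 0≤Σ ⟩
    x + (y + (z + c))     ≤⟨ ℤ.+-mono-≤ (coefficient-≤ l 0≤x)
                               (ℤ.+-mono-≤ (coefficient-≤ m 0≤y) (ℤ.+-monoˡ-≤ c (coefficient-≤ n 0≤z))) ⟩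
    x * + suc l + (y * + suc m + (z * + suc n + c))
      ≡⟨ solve 4 (λ X Y Z c → X :+ (Y :+ (Z :+ c)) := c :* con 1ℤ :+ (X :+ (Y :+ (Z :+ con 0ℤ)))) refl
           (x * + suc l) (y * + suc m) (z * + suc n) c ⟩
    ⟦ c ∷ x ∷ y ∷ z ∷ [] ⟧ ρ ∎
    where open ℤ.≤-Reasoning

  within-sound : ∀ {u} f {k} → InRange u k → Within u f → 0ℤ ℤ.≤ val f k
  within-sound {u} (c ∷ f) k∈u w = ℤ.≤-trans (nonnegative-sound (lower u c f) w) (lower-≤ u c f k∈u)

  inside-sound : ∀ {u} v ι {k} → InRange u k → Inside u v ι → InRange v (val ι k)
  inside-sound v ι {k} k∈u (w , w′) = within-sound ι k∈u w ,
    ℤ.0≤i-j⇒j≤i (subst (0ℤ ℤ.≤_) (trans (⟦⊝⟧ (at v) ι (k ∷ ρ)) (cong (_- val ι k) (val-at v k)))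
      (within-sound (at v ⊝ ι) k∈u w′))

  ∣-form : ∀ {r q} (f : Form r) σ → All (q ∣_) (Vec.toList f) → q ∣ ⟦ f ⟧ σ
  ∣-form [] [] [] = divides 0ℤ refl
  ∣-form (c ∷ f) (x ∷ σ) (q∣c ∷ q∣f) = ∣m∣n⇒∣m+n (∣m⇒∣m*n x q∣c) (∣-form f σ q∣f)

  -- At a zero, the constant term would be minus a sum of multiples of the modulus.
  indivisible-sound : ∀ {q} f {k j} → Indivisible q f → ⟦ f ⟧ (j ∷ k ∷ ρ) ≢ 0ℤ
  indivisible-sound {q} f@(d ∷ c ∷ e ∷ g) {k} {j} (q∣d ∷ q∣c ∷ q∣g , q∤e) eq =
    q∤e (∣m+n∣n⇒∣m (subst (q ∣_) (sym reorder) (divides 0ℤ eq))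
      (∣m∣n⇒∣m+n (∣m⇒∣m*n j q∣d) (∣m∣n⇒∣m+n (∣m⇒∣m*n k q∣c) (∣-form g _ q∣g))))
    where
    reorder : e + (d * j + (c * k + ⟦ g ⟧ _)) ≡ ⟦ f ⟧ (j ∷ k ∷ ρ)
    reorder = solve 4 (λ e D C G → e :+ (D :+ (C :+ G)) := D :+ (C :+ (e :* con 1ℤ :+ G))) refl
      e (d * j) (c * k) (⟦ g ⟧ _)

  nonvanishing-sound : ∀ {u v} f {k j} → InRange u k → InRange v j → Nonvanishing u v f → ⟦ f ⟧ (j ∷ k ∷ ρ) ≢ 0ℤ
  nonvanishing-sound {u} {v} f@(d ∷ c ∷ g) {k} {j} k∈u j∈v (inj₂ (inj₁ pos)) eq =
    ℤ.<-irrefl (sym eq) (ℤ.<-≤-trans (ℤ.<-≤-trans (+<+ (s≤s z≤n)) 1≤) low)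
    where
    1≤ : 1ℤ ℤ.≤ ⟦ lower₂ u v f ⟧ ρ
    1≤ = ℤ.0≤i-j⇒j≤i (subst (0ℤ ℤ.≤_) (⟦pred⟧ (lower₂ u v f)) (nonnegative-sound _ pos))
    low : ⟦ lower₂ u v f ⟧ ρ ℤ.≤ ⟦ f ⟧ (j ∷ k ∷ ρ)
    low = begin
      ⟦ lower u c (lower v d g) ⟧ ρ     ≤⟨ lower-≤ u c (lower v d g) k∈u ⟩
      c * k + ⟦ lower v d g ⟧ ρ         ≤⟨ ℤ.+-monoʳ-≤ (c * k) (lower-≤ v d g j∈v) ⟩
      c * k + (d * j + ⟦ g ⟧ ρ)
        ≡⟨ solve 3 (λ x y z → x :+ (y :+ z) := y :+ (x :+ z)) refl (c * k) (d * j) (⟦ g ⟧ ρ) ⟩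
      d * j + (c * k + ⟦ g ⟧ ρ)         ∎
      where open ℤ.≤-Reasoning
  nonvanishing-sound f k∈u j∈v (inj₁ ind) = indivisible-sound f ind
  nonvanishing-sound f k∈u j∈v (inj₂ (inj₂ ind)) = indivisible-sound f ind

  combine-vanishes : ∀ {r} cs (fs : List (Form r)) σ → All (λ f → ⟦ f ⟧ σ ≡ 0ℤ) fs → ⟦ combine cs fs ⟧ σ ≡ 0ℤ
  combine-vanishes (c ∷ cs) (f ∷ fs) σ (z ∷ zs) = trans (⟦⊕⟧ (c ⊙ f) (combine cs fs) σ)
    (cong₂ _+_ (trans (⟦⊙⟧ c f σ) (trans (cong (c *_) z) (ℤ.*-zeroʳ c))) (combine-vanishes cs fs σ zs))
  combine-vanishes [] _ σ _ = ⟦𝟎⟧ σ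
  combine-vanishes (_ ∷ _) [] σ _ = ⟦𝟎⟧ σ

  separated-sound : ∀ {Λ u v} fs {k j} → InRange u k → InRange v j → Separated Λ u v fs →
    ¬ All (λ f → ⟦ f ⟧ (j ∷ k ∷ ρ) ≡ 0ℤ) fs
  separated-sound fs k∈u j∈v (here {cs} s) zs =
    nonvanishing-sound (combine cs fs) k∈u j∈v s (combine-vanishes cs fs _ zs)
  separated-sound {Λ = _ ∷ Λ} fs k∈u j∈v (there s) zs = separated-sound {Λ = Λ} fs k∈u j∈v s zs

-- The hexagons of FCS a b c

shift : Hex → Hex → ℕ → Hex
shift (u , v) (du , dv) i = du * + i + u , dv * + i + v

shift-suc : ∀ p q d i → shift (p , q) d (suc i) ≡ shift (p + proj₁ d , q + proj₂ d) d i
shift-suc p q (du , dv) i = cong₂ _,_ (advance du p) (advance dv q)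
  where
  advance : ∀ d x → d * + suc i + x ≡ d * + i + (x + d)
  advance d x = solve 3 (λ d x i → d :* (con 1ℤ :+ i) :+ x := d :* i :+ (x :+ d)) refl d x (+ i)

shift-zero : ∀ p d → shift p d 0 ≡ p
shift-zero (p , q) (du , dv) = cong₂ _,_ (zero′ du p) (zero′ dv q)
  where
  zero′ : ∀ d x → d * 0ℤ + x ≡ x
  zero′ d x = trans (cong (_+ x) (ℤ.*-zeroʳ d)) (ℤ.+-identityˡ x)

chain-∈⁻ : ∀ p d N {h} → h ∈ chain p d N → ∃ λ i → i ℕ.< N × h ≡ shift p d i
chain-∈⁻ p d (suc N) (here refl) = 0 , z<s , sym (shift-zero p d)
chain-∈⁻ p@(u , v) d (suc N) (there h∈) with i , i<N , refl ← chain-∈⁻ _ d N h∈ =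
  suc i , s<s i<N , sym (shift-suc u v d i)

chain-∈⁺ : ∀ p d {N i} → i ℕ.< N → shift p d i ∈ chain p d N
chain-∈⁺ p d {suc N} {zero} _ = here (shift-zero p d)
chain-∈⁺ (u , v) d {suc N} {suc i} (s≤s i<N) =
  there (subst (_∈ chain _ d N) (sym (shift-suc u v d i)) (chain-∈⁺ _ d i<N))

opposite : Hex → Hex
opposite (du , dv) = - du , - dv

-- Allows a chain listed from its far end to be read from the hub.
shift-back : ∀ p d i {j M} → i ℕ.+ j ≡ M → shift (shift p d M) (opposite d) i ≡ shift p d j
shift-back (u , v) (du , dv) i {j} refl = cong₂ _,_ (back du u) (back dv v)
  where
  back : ∀ d x → - d * + i + (d * + (i ℕ.+ j) + x) ≡ d * + j + x
  back d x = solve 4 (λ d x i j → :- d :* i :+ (d :* (i :+ j) :+ x) := d :* j :+ x) refl d x (+ i) (+ j)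

module _ {h : Hex} (S₁ S₂ S₃ S₄ S₅ S₆ T₁ T₂ T₃ : List Hex) where

  -- The chains in the conclusion are ordered as in `ribbons`: the three arms, then the sides in the
  -- order of `rims`.
  nine⁻ : h ∈ (S₁ ++ S₂ ++ S₃ ++ S₄ ++ S₅ ++ S₆) ++ (T₁ ++ T₂ ++ T₃) →
          Any (h ∈_) (T₁ ∷ T₂ ∷ T₃ ∷ S₅ ∷ S₄ ∷ S₃ ∷ S₂ ∷ S₁ ∷ S₆ ∷ [])
  nine⁻ h∈ with ∈-++⁻ (S₁ ++ S₂ ++ S₃ ++ S₄ ++ S₅ ++ S₆) h∈
  ... | inj₂ h∈ with ∈-++⁻ T₁ h∈
  ...   | inj₁ h∈ = here h∈
  ...   | inj₂ h∈ with ∈-++⁻ T₂ h∈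
  ...     | inj₁ h∈ = there (here h∈)
  ...     | inj₂ h∈ = there (there (here h∈))
  nine⁻ _ | inj₁ h∈ with ∈-++⁻ S₁ h∈
  ... | inj₁ h∈ = there (there (there (there (there (there (there (here h∈)))))))
  ... | inj₂ h∈ with ∈-++⁻ S₂ h∈
  ...   | inj₁ h∈ = there (there (there (there (there (there (here h∈))))))
  ...   | inj₂ h∈ with ∈-++⁻ S₃ h∈
  ...     | inj₁ h∈ = there (there (there (there (there (here h∈)))))
  ...     | inj₂ h∈ with ∈-++⁻ S₄ h∈
  ...       | inj₁ h∈ = there (there (there (there (here h∈))))
  ...       | inj₂ h∈ with ∈-++⁻ S₅ h∈
  ...         | inj₁ h∈ = there (there (there (here h∈)))
  ...         | inj₂ h∈ = there (there (there (there (there (there (there (there (here h∈))))))))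

  nine⁺ : Any (h ∈_) (T₁ ∷ T₂ ∷ T₃ ∷ S₅ ∷ S₄ ∷ S₃ ∷ S₂ ∷ S₁ ∷ S₆ ∷ []) →
          h ∈ (S₁ ++ S₂ ++ S₃ ++ S₄ ++ S₅ ++ S₆) ++ (T₁ ++ T₂ ++ T₃)
  nine⁺ (here p) = ∈-++⁺ʳ (S₁ ++ S₂ ++ S₃ ++ S₄ ++ S₅ ++ S₆) (∈-++⁺ˡ p)
  nine⁺ (there (here p)) = ∈-++⁺ʳ (S₁ ++ S₂ ++ S₃ ++ S₄ ++ S₅ ++ S₆) (∈-++⁺ʳ T₁ (∈-++⁺ˡ p))
  nine⁺ (there (there (here p))) = ∈-++⁺ʳ (S₁ ++ S₂ ++ S₃ ++ S₄ ++ S₅ ++ S₆) (∈-++⁺ʳ T₁ (∈-++⁺ʳ T₂ p))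
  nine⁺ (there (there (there (here p)))) =
    ∈-++⁺ˡ (∈-++⁺ʳ S₁ (∈-++⁺ʳ S₂ (∈-++⁺ʳ S₃ (∈-++⁺ʳ S₄ (∈-++⁺ˡ p)))))
  nine⁺ (there (there (there (there (here p))))) = ∈-++⁺ˡ (∈-++⁺ʳ S₁ (∈-++⁺ʳ S₂ (∈-++⁺ʳ S₃ (∈-++⁺ˡ p))))
  nine⁺ (there (there (there (there (there (here p)))))) = ∈-++⁺ˡ (∈-++⁺ʳ S₁ (∈-++⁺ʳ S₂ (∈-++⁺ˡ p)))
  nine⁺ (there (there (there (there (there (there (here p))))))) = ∈-++⁺ˡ (∈-++⁺ʳ S₁ (∈-++⁺ˡ p))
  nine⁺ (there (there (there (there (there (there (there (here p)))))))) = ∈-++⁺ˡ (∈-++⁺ˡ p)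
  nine⁺ (there (there (there (there (there (there (there (there (here p))))))))) =
    ∈-++⁺ˡ (∈-++⁺ʳ S₁ (∈-++⁺ʳ S₂ (∈-++⁺ʳ S₃ (∈-++⁺ʳ S₄ (∈-++⁺ʳ S₅ p)))))

module Geometry (l m n : ℕ) where

  open Box l m n public

  a b c : ℕ
  a = 4 ℕ.+ l
  b = 4 ℕ.+ m
  c = 4 ℕ.+ n

  G : Graph
  G = FCS a b c

  A B C : ℤ
  A = + suc l
  B = + suc m
  C = + suc n

  hexes : List Hex
  hexes = coronoidHexes a b c ++ starpheneHexes a b c

  S₁ S₂ S₃ S₄ S₅ S₆ T₁ T₂ T₃ : List Hex
  S₁ = chain (+ 0 , + 0) (+ 1 , + 0) a
  S₂ = chain (+ a - + 1 , + 0) (+ 0 , + 1) b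
  S₃ = chain (+ a - + 1 , + b - + 1) (-1ℤ , + 1) c
  S₄ = chain (+ a - + c , + b + + c - + 2) (-1ℤ , + 0) a
  S₅ = chain (+ 1 - + c , + b + + c - + 2) (+ 0 , -1ℤ) b
  S₆ = chain (+ 1 - + c , + c - + 1) (+ 1 , -1ℤ) c
  T₁ = chain (+ a - + c , + c - + 1) (-1ℤ , + 0) (a ℕ.∸ 1)
  T₂ = chain (+ a - + c , + c - + 1) (+ 0 , + 1) (b ℕ.∸ 1)
  T₃ = chain (+ a - + c , + c - + 1) (+ 1 , -1ℤ) (c ℕ.∸ 1)

  corner direction : Ribbon → Hex
  corner r = ⟦ cornerU (Ribbon.hub r) ⟧ ρ , ⟦ cornerV (Ribbon.hub r) ⟧ ρ
  direction r = hexSpeed (Ribbon.hub r) (Ribbon.axis r)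

  hexAt : Ribbon → ℤ → Hex
  hexAt r i = val (proj₁ (hexPath r)) i , val (proj₂ (hexPath r)) i

  Along : Ribbon → ℕ → Hex → Set
  Along r N h = ∃ λ i → i ℕ.< N × h ≡ hexAt r (+ i)

  record Traces (r : Ribbon) (N : ℕ) (hs : List Hex) : Set where
    field
      to   : ∀ {h} → h ∈ hs → Along r N h
      from : ∀ {h} → Along r N h → h ∈ hs

  forward : ∀ r {N p d} → p ≡ corner r → d ≡ direction r → Traces r N (chain p d N)
  forward r {N} refl refl = record
    { to   = chain-∈⁻ _ _ N
    ; from = λ where (i , i<N , refl) → chain-∈⁺ (corner r) (direction r) i<N }

  backward : ∀ r {M p d} → p ≡ shift (corner r) (direction r) M → d ≡ opposite (direction r) →
             Traces r (suc M) (chain p d (suc M))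
  backward r {M} refl refl = record
    { to   = λ h∈ → let i , i<N , eq = chain-∈⁻ _ _ (suc M) h∈ in
        M ℕ.∸ i , s≤s (ℕ.m∸n≤m M i) ,
        trans eq (shift-back (corner r) (direction r) i (ℕ.m+[n∸m]≡n (ℕ.≤-pred i<N)))
    ; from = λ where
        (j , j<N , refl) → subst (_∈ chain _ _ (suc M))
          (shift-back (corner r) (direction r) (M ℕ.∸ j) (ℕ.m∸n+n≡m (ℕ.≤-pred j<N)))
          (chain-∈⁺ (shift (corner r) (direction r) M) (opposite (direction r)) (s≤s (ℕ.m∸n≤m M j))) }

  -- Mirrors the unfolding of `⟦_⟧` at `ρ` term by term, so that the equations of the ring solver
  -- apply to evaluated forms.
  form : Form 4 → (A B C : Polynomial 3) → Polynomial 3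
  form (c ∷ x ∷ y ∷ z ∷ []) A B C =
    con c :* con 1ℤ :+ (con x :* A :+ (con y :* B :+ (con z :* C :+ con 0ℤ)))

  r₁ r₂ r₃ r₄ r₅ r₆ r₇ r₈ r₉ : Ribbon
  r₁ = Vec.lookup (Vec.fromList ribbons) (# 0)
  r₂ = Vec.lookup (Vec.fromList ribbons) (# 1)
  r₃ = Vec.lookup (Vec.fromList ribbons) (# 2)
  r₄ = Vec.lookup (Vec.fromList ribbons) (# 3)
  r₅ = Vec.lookup (Vec.fromList ribbons) (# 4)
  r₆ = Vec.lookup (Vec.fromList ribbons) (# 5)
  r₇ = Vec.lookup (Vec.fromList ribbons) (# 6)
  r₈ = Vec.lookup (Vec.fromList ribbons) (# 7)
  r₉ = Vec.lookup (Vec.fromList ribbons) (# 8)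

  side₁ : Traces r₈ a S₁
  side₁ = forward r₈ (cong₂ _,_
    (solve 3 (λ A B C → con (+ 0) := form (cornerU Q₃₁) A B C) refl A B C)
    (solve 3 (λ A B C → con (+ 0) := form (cornerV Q₃₁) A B C) refl A B C)) refl

  -- This chain is listed from the cluster towards `Q₂₃`, hence `backward`; its far end has index b
  -- - 1, which is 2 + B.
  side₂ : Traces r₇ b S₂
  side₂ = backward r₇ (cong₂ _,_
    (solve 3 (λ A B C → (con (+ 3) :+ A) :- con (+ 1)
      := con (+ 0) :* (con (+ 2) :+ B) :+ form (cornerU Q₂₃) A B C) refl A B C)
    (solve 3 (λ A B C → con (+ 0)
      := con -1ℤ :* (con (+ 2) :+ B) :+ form (cornerV Q₂₃) A B C) refl A B C)) refl

  side₃ : Traces r₆ c S₃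
  side₃ = forward r₆ (cong₂ _,_
    (solve 3 (λ A B C → (con (+ 3) :+ A) :- con (+ 1) := form (cornerU Q₂₃) A B C) refl A B C)
    (solve 3 (λ A B C → (con (+ 3) :+ B) :- con (+ 1) := form (cornerV Q₂₃) A B C) refl A B C)) refl

  side₄ : Traces r₅ a S₄
  side₄ = backward r₅ (cong₂ _,_
    (solve 3 (λ A B C → (con (+ 3) :+ A) :- (con (+ 3) :+ C)
      := con (+ 1) :* (con (+ 2) :+ A) :+ form (cornerU Q₁₂) A B C) refl A B C)
    (solve 3 (λ A B C → (con (+ 3) :+ B) :+ (con (+ 3) :+ C) :- con (+ 2)
      := con (+ 0) :* (con (+ 2) :+ A) :+ form (cornerV Q₁₂) A B C) refl A B C)) refl

  side₅ : Traces r₄ b S₅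
  side₅ = forward r₄ (cong₂ _,_
    (solve 3 (λ A B C → con (+ 1) :- (con (+ 3) :+ C) := form (cornerU Q₁₂) A B C) refl A B C)
    (solve 3 (λ A B C → (con (+ 3) :+ B) :+ (con (+ 3) :+ C) :- con (+ 2) := form (cornerV Q₁₂) A B C) refl A B C)) refl

  side₆ : Traces r₉ c S₆
  side₆ = backward r₉ (cong₂ _,_
    (solve 3 (λ A B C → con (+ 1) :- (con (+ 3) :+ C)
      := con -1ℤ :* (con (+ 2) :+ C) :+ form (cornerU Q₃₁) A B C) refl A B C)
    (solve 3 (λ A B C → (con (+ 3) :+ C) :- con (+ 1)
      := con (+ 1) :* (con (+ 2) :+ C) :+ form (cornerV Q₃₁) A B C) refl A B C)) refl

  center : (+ a - + c , + c - + 1) ≡ (⟦ cornerU Z ⟧ ρ , ⟦ cornerV Z ⟧ ρ)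
  center = cong₂ _,_
    (solve 3 (λ A B C → (con (+ 3) :+ A) :- (con (+ 3) :+ C) := form (cornerU Z) A B C) refl A B C)
    (solve 3 (λ A B C → (con (+ 3) :+ C) :- con (+ 1) := form (cornerV Z) A B C) refl A B C)

  arm₁ : Traces r₁ (a ℕ.∸ 1) T₁
  arm₁ = forward r₁ center refl

  arm₂ : Traces r₂ (b ℕ.∸ 1) T₂
  arm₂ = forward r₂ center refl

  arm₃ : Traces r₃ (c ℕ.∸ 1) T₃
  arm₃ = forward r₃ center refl

  open Traces

  -- One less than the ribbon length, the parameters being `suc l`, `suc m` and `suc n`; hence an
  -- arm has `3 + size` hexagons with its centre, and a side `4 + size`.
  size : Ribbon → ℕ
  size r = Vec.lookup (l ∷ m ∷ n ∷ []) (Ribbon.axis r)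

  ⟦len⟧ : ∀ ℓ → ⟦ len ℓ ⟧ ρ ≡ + suc (Vec.lookup (l ∷ m ∷ n ∷ []) ℓ)
  ⟦len⟧ 𝕒 = solve 3 (λ A B C → form (len 𝕒) A B C := A) refl A B C
  ⟦len⟧ 𝕓 = solve 3 (λ A B C → form (len 𝕓) A B C := B) refl A B C
  ⟦len⟧ 𝕔 = solve 3 (λ A B C → form (len 𝕔) A B C := C) refl A B C

  hexes-along : ∀ {h} → h ∈ hexes →
    Any (λ r → Along r (3 ℕ.+ size r) h) spokes ⊎ Any (λ r → Along r (4 ℕ.+ size r) h) rims
  hexes-along h∈ with nine⁻ S₁ S₂ S₃ S₄ S₅ S₆ T₁ T₂ T₃ h∈
  ... | here p = inj₁ (here (to arm₁ p))
  ... | there (here p) = inj₁ (there (here (to arm₂ p)))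
  ... | there (there (here p)) = inj₁ (there (there (here (to arm₃ p))))
  ... | there (there (there (here p))) = inj₂ (here (to side₅ p))
  ... | there (there (there (there (here p)))) = inj₂ (there (here (to side₄ p)))
  ... | there (there (there (there (there (here p))))) = inj₂ (there (there (here (to side₃ p))))
  ... | there (there (there (there (there (there (here p)))))) = inj₂ (there (there (there (here (to side₂ p)))))
  ... | there (there (there (there (there (there (there (here p))))))) =
    inj₂ (there (there (there (there (here (to side₁ p))))))
  ... | there (there (there (there (there (there (there (there (here p)))))))) =
    inj₂ (there (there (there (there (there (here (to side₆ p)))))))

  hexes⁺ : ∀ {h} → Any (h ∈_) (T₁ ∷ T₂ ∷ T₃ ∷ S₅ ∷ S₄ ∷ S₃ ∷ S₂ ∷ S₁ ∷ S₆ ∷ []) → h ∈ hexes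
  hexes⁺ = nine⁺ S₁ S₂ S₃ S₄ S₅ S₆ T₁ T₂ T₃

  spokes-hexes : All (λ r → ∀ {h} → Along r (3 ℕ.+ size r) h → h ∈ hexes) spokes
  spokes-hexes =
    (λ p → hexes⁺ (here (from arm₁ p))) ∷
    (λ p → hexes⁺ (there (here (from arm₂ p)))) ∷
    (λ p → hexes⁺ (there (there (here (from arm₃ p))))) ∷ []

  rims-hexes : All (λ r → ∀ {h} → Along r (4 ℕ.+ size r) h → h ∈ hexes) rims
  rims-hexes =
    (λ p → hexes⁺ (there (there (there (here (from side₅ p)))))) ∷
    (λ p → hexes⁺ (there (there (there (there (here (from side₄ p))))))) ∷
    (λ p → hexes⁺ (there (there (there (there (there (here (from side₃ p)))))))) ∷
    (λ p → hexes⁺ (there (there (there (there (there (there (here (from side₂ p))))))))) ∷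
    (λ p → hexes⁺ (there (there (there (there (there (there (there (here (from side₁ p)))))))))) ∷
    (λ p → hexes⁺ (there (there (there (there (there (there (there (there (here (from side₆ p))))))))))) ∷ []

  cellHex : Cell → ℤ → Hex
  cellHex (cell u v _) k = val u k , val v k

  cellHex-at : ∀ r ι u k → cellHex (cellOf r ι u) k ≡ hexAt r (val ι k)
  cellHex-at r ι u k = cong₂ _,_ (val-sub (proj₁ (hexPath r)) ι k) (val-sub (proj₂ (hexPath r)) ι k)

  val-next : ∀ k → val next k ≡ 1ℤ + k
  val-next k = trans (cong₂ _+_ (ℤ.*-identityˡ k) (⟦const⟧ 1ℤ)) (ℤ.+-comm k 1ℤ)

  zero∈ : InRange 𝟎 0ℤ
  zero∈ = ℤ.≤-refl , ℤ.≤-reflexive (sym (⟦𝟎⟧ ρ))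

  ∈zero : ∀ {k} → InRange 𝟎 k → k ≡ 0ℤ
  ∈zero (0≤k , k≤0) = ℤ.≤-antisym (ℤ.≤-trans k≤0 (ℤ.≤-reflexive (⟦𝟎⟧ ρ))) 0≤k

  ⟦len+⟧ : ∀ ℓ q → ⟦ len ℓ ⊕ const q ⟧ ρ ≡ q + + suc (Vec.lookup (l ∷ m ∷ n ∷ []) ℓ)
  ⟦len+⟧ ℓ q = trans (⟦⊕⟧ (len ℓ) (const q) ρ) (trans (cong₂ _+_ (⟦len⟧ ℓ) (⟦const⟧ q)) (ℤ.+-comm _ q))

  ⟦len-1⟧ : ∀ ℓ → ⟦ len ℓ ⊝ const 1ℤ ⟧ ρ ≡ + Vec.lookup (l ∷ m ∷ n ∷ []) ℓ
  ⟦len-1⟧ ℓ = trans (⟦pred⟧ (len ℓ)) (cong (_- 1ℤ) (⟦len⟧ ℓ))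

  IsCell : Hex → Cell → Set
  IsCell h c = ∃ λ k → InRange (crange c) k × h ≡ cellHex c k

  is-cell : ∀ r ι u {k i} → InRange u k → val ι k ≡ i → IsCell (hexAt r i) (cellOf r ι u)
  is-cell r ι u {k} k∈ eq = k , k∈ , trans (cong (hexAt r) (sym eq)) (sym (cellHex-at r ι u k))

  spoke-cells : ∀ r {h} → Along r (3 ℕ.+ size r) h → Any (IsCell h) (spokeCells r)
  spoke-cells r (zero , _ , refl) = here (is-cell r 𝟎 𝟎 zero∈ (⟦𝟎⟧ (0ℤ ∷ ρ)))
  -- Hexagon i + 1 lies between two rungs exactly when i is at most the ribbon length minus one,
  -- which is `size r`.
  spoke-cells r (suc i , s≤s i<N , refl) with i ℕ.≤? size r
  ... | yes i≤L = there (here (is-cell r next (len (Ribbon.axis r) ⊝ const 1ℤ) {+ i} (+≤+ z≤n , i≤) (val-next (+ i))))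
    where
    i≤ : + i ℤ.≤ ⟦ len (Ribbon.axis r) ⊝ const 1ℤ ⟧ ρ
    i≤ = subst (+ i ℤ.≤_) (sym (⟦len-1⟧ (Ribbon.axis r))) (+≤+ i≤L)
  ... | no i≰L = there (there (here (is-cell r (at (len (Ribbon.axis r) ⊕ const 1ℤ)) 𝟎 zero∈
      (trans (val-at (len (Ribbon.axis r) ⊕ const 1ℤ) 0ℤ) (trans (⟦len+⟧ (Ribbon.axis r) 1ℤ)
        (cong (λ j → + suc j) (sym (ℕ.≤-antisym (ℕ.≤-pred i<N) (ℕ.≰⇒> i≰L)))))))))

  rim-cells : ∀ r {h} → Along r (4 ℕ.+ size r) h → Any (IsCell h) (rimCells r)
  rim-cells r (i , i<N , eq) with i ℕ.<? 3 ℕ.+ size r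
  ... | yes i< = there (spoke-cells r (i , i< , eq))
  rim-cells r (i , i<N , refl) | no i≮ = here (is-cell r (at (len (Ribbon.axis r) ⊕ const (+ 2))) 𝟎 zero∈
      (trans (val-at (len (Ribbon.axis r) ⊕ const (+ 2)) 0ℤ) (trans (⟦len+⟧ (Ribbon.axis r) (+ 2))
        (cong +_ (ℕ.≤-antisym (ℕ.≮⇒≥ i≮) (ℕ.≤-pred i<N))))))

  opaque
    unfolding cells
    hex-cell : ∀ {h} → h ∈ hexes → Any (IsCell h) cells
    hex-cell h∈ with hexes-along h∈
    ... | inj₁ p with r , r∈ , q ← find p =
      Any.++⁺ˡ (Any.concatMap⁺ spokeCells (lose r∈ (spoke-cells r q)))
    ... | inj₂ p with r , r∈ , q ← find p =
      Any.++⁺ʳ (concatMap spokeCells spokes) (Any.concatMap⁺ rimCells (lose r∈ (rim-cells r q)))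

  along : ∀ r ι u {N k i} → val ι k ≡ + i → i ℕ.< N → Along r N (cellHex (cellOf r ι u) k)
  along r ι u {k = k} {i} eq i<N = i , i<N , trans (cellHex-at r ι u k) (cong (hexAt r) eq)

  spoke-along : ∀ r →
    All (λ c → ∀ {k} → InRange (crange c) k → Along r (3 ℕ.+ size r) (cellHex c k)) (spokeCells r)
  spoke-along r =
    (λ {k} _ → along r 𝟎 𝟎 {k = k} (⟦𝟎⟧ (k ∷ ρ)) z<s) ∷
    middle ∷
    (λ {k} _ → along r (at (len (Ribbon.axis r) ⊕ const 1ℤ)) 𝟎 {k = k}
      (trans (val-at (len (Ribbon.axis r) ⊕ const 1ℤ) k) (⟦len+⟧ (Ribbon.axis r) 1ℤ)) ℕ.≤-refl) ∷ []
    where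
    middle : ∀ {k} → InRange (len (Ribbon.axis r) ⊝ const 1ℤ) k →
      Along r (3 ℕ.+ size r) (cellHex (cellOf r next (len (Ribbon.axis r) ⊝ const 1ℤ)) k)
    middle {+ i} (_ , i≤) with +≤+ i≤L ← subst (+ i ℤ.≤_) (⟦len-1⟧ (Ribbon.axis r)) i≤ =
      along r next (len (Ribbon.axis r) ⊝ const 1ℤ) {k = + i} (val-next (+ i)) (s≤s (s≤s (ℕ.m≤n⇒m≤1+n i≤L)))

  rim-along : ∀ r →
    All (λ c → ∀ {k} → InRange (crange c) k → Along r (4 ℕ.+ size r) (cellHex c k)) (rimCells r)
  rim-along r =
    (λ {k} _ → along r (at (len (Ribbon.axis r) ⊕ const (+ 2))) 𝟎 {k = k}
      (trans (val-at (len (Ribbon.axis r) ⊕ const (+ 2)) k) (⟦len+⟧ (Ribbon.axis r) (+ 2))) ℕ.≤-refl) ∷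
    All.map (λ f {k} k∈ → widen (f {k} k∈)) (spoke-along r)
    where
    widen : ∀ {N h} → Along r N h → Along r (suc N) h
    widen (i , i< , eq) = i , ℕ.m≤n⇒m≤1+n i< , eq

  opaque
    unfolding cells
    cell-hex : ∀ {c k} → c ∈ cells → InRange (crange c) k → cellHex c k ∈ hexes
    cell-hex {c} c∈ k∈ with Any.++⁻ (concatMap spokeCells spokes) c∈
    ... | inj₁ p with r , r∈ , q ← find (Any.concatMap⁻ spokeCells p) =
      All.lookup spokes-hexes r∈ (All.lookup (spoke-along r) q k∈)
    ... | inj₂ p with r , r∈ , q ← find (Any.concatMap⁻ rimCells p) =
      All.lookup rims-hexes r∈ (All.lookup (rim-along r) q k∈)

-- Distances in FCS a b c

lookup-pair : ∀ {X : Set} {R : X → X → Set} {xs x y} → AllPairs R xs → x ∈ xs → y ∈ xs → x ≡ y ⊎ R x y ⊎ R y x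
lookup-pair (_ ∷ _)   (here refl) (here refl) = inj₁ refl
lookup-pair (rs ∷ _)  (here refl) (there y∈)  = inj₂ (inj₁ (All.lookup rs y∈))
lookup-pair (rs ∷ _)  (there x∈)  (here refl) = inj₂ (inj₂ (All.lookup rs x∈))
lookup-pair (_ ∷ ps)  (there x∈)  (there y∈)  = lookup-pair ps x∈ y∈

hexVert-edge : ∀ h {v} → v ∈ hexVerts h → ∃ λ w → (v , w) ∈ hexEdges h ⊎ (w , v) ∈ hexEdges h
hexVert-edge h (here refl) = _ , inj₁ (here refl)
hexVert-edge h (there (here refl)) = _ , inj₂ (here refl)
hexVert-edge h (there (there (here refl))) = _ , inj₂ (there (here refl))
hexVert-edge h (there (there (there (here refl)))) = _ , inj₁ (there (there (here refl)))
hexVert-edge h (there (there (there (there (here refl))))) = _ , inj₂ (there (there (here refl)))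
hexVert-edge h (there (there (there (there (there (here refl)))))) = _ , inj₂ (there (there (there (here refl))))

hexEdge-verts : ∀ h {v w} → (v , w) ∈ hexEdges h → v ∈ hexVerts h × w ∈ hexVerts h
hexEdge-verts h (here refl) = here refl , there (here refl)
hexEdge-verts h (there (here refl)) = there (here refl) , there (there (here refl))
hexEdge-verts h (there (there (here refl))) =
  there (there (there (here refl))) , there (there (there (there (here refl))))
hexEdge-verts h (there (there (there (here refl)))) =
  there (there (there (there (here refl)))) , there (there (there (there (there (here refl)))))
hexEdge-verts h (there (there (there (there (here refl))))) = here refl , there (there (there (here refl)))
hexEdge-verts h (there (there (there (there (there (here refl)))))) =
  there (there (here refl)) , there (there (there (there (there (here refl)))))

Adj-sym : ∀ {G v w} → Adj G v w → Adj G w v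
Adj-sym (inj₁ e) = inj₂ e
Adj-sym (inj₂ e) = inj₁ e

module Metric (l m n : ℕ) where

  open Geometry l m n

  loc : Family → ℤ → Vtx
  loc f k = val (locX f) k , val (locY f) k

  place : Point → ℤ → Vtx
  place p k = loc (fam p) (val (idx p) k)

  evalSpot : ℤ → Spot → Vtx
  evalSpot k (x , y) = val x k , val y k

  evalSpots : ℤ → Spot × Spot → Vtx × Vtx
  evalSpots k (s , t) = evalSpot k s , evalSpot k t

  evalSpot-spot : ∀ k p → evalSpot k (spot p) ≡ place p k
  evalSpot-spot k p = cong₂ _,_ (val-sub (locX (fam p)) (idx p) k) (val-sub (locY (fam p)) (idx p) k)

  evalSpot-sub : ∀ k s η → evalSpot k (subˢ s η) ≡ evalSpot (val η k) s
  evalSpot-sub k (x , y) η = cong₂ _,_ (val-sub x η k) (val-sub y η k)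

  evalSpot-place : ∀ k p η → evalSpot k (subˢ (spot p) η) ≡ place p (val η k)
  evalSpot-place k p η = trans (evalSpot-sub k (spot p) η) (evalSpot-spot (val η k) p)

  hexEdges-spots : ∀ c k → hexEdges (cellHex c k) ≡ map (evalSpots k) (spots c)
  hexEdges-spots (cell u v _) k = cong₂ _∷_ (bond x₀ y₀ x₁ y₀) $ cong₂ _∷_ (bond x₁ y₀ x₂ y₀) $
    cong₂ _∷_ (bond x₀ y₁ x₁ y₁) $ cong₂ _∷_ (bond x₁ y₁ x₂ y₁) $
    cong₂ _∷_ (bond x₀ y₀ x₀ y₁) $ cong₂ _∷_ (bond x₂ y₀ x₂ y₁) refl
    where
    bond : ∀ {p q r s p′ q′ r′ s′ : ℤ} → p ≡ p′ → q ≡ q′ → r ≡ r′ → s ≡ s′ →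
      ((p , q) , (r , s)) ≡ ((p′ , q′) , (r′ , s′))
    bond refl refl refl refl = refl
    xs : ∀ x → + 2 * val u k + val v k + x ≡ val (+ 2 ⊙ u ⊕ v ⊕ at (const x)) k
    xs x = sym (trans (⟦⊕⟧ (+ 2 ⊙ u ⊕ v) (at (const x)) (k ∷ ρ)) (cong₂ _+_
      (trans (⟦⊕⟧ (+ 2 ⊙ u) v (k ∷ ρ)) (cong (_+ val v k) (⟦⊙⟧ (+ 2) u (k ∷ ρ))))
      (trans (val-at (const x) k) (⟦const⟧ x))))
    ys : ∀ y → val v k + y ≡ val (v ⊕ at (const y)) k
    ys y = sym (trans (⟦⊕⟧ v (at (const y)) (k ∷ ρ))
      (cong (λ z → val v k + z) (trans (val-at (const y) k) (⟦const⟧ y))))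
    x₀ = trans (sym (ℤ.+-identityʳ _)) (xs 0ℤ)
    x₁ = xs 1ℤ
    x₂ = xs (+ 2)
    y₀ = trans (sym (ℤ.+-identityʳ _)) (ys 0ℤ)
    y₁ = ys 1ℤ

  -- Carries a property checked on the parts of a split to a given index of the full range.
  splits-sound : ∀ {Q : Part → Set} u {k} → InRange u k → Any (All Q) (splits u) →
    ∃ λ p → ∃ λ j → Q p × InRange (proj₂ p) j × k ≡ val (proj₁ p) j
  splits-sound u {k} k∈ s with u ≟ᶠ 𝟎
  splits-sound u {k} k∈ (here (q ∷ [])) | yes refl =
    _ , 0ℤ , q , zero∈ , trans (∈zero k∈) (sym (⟦𝟎⟧ (0ℤ ∷ ρ)))
  splits-sound u {k} k∈ (here (q ∷ [])) | no _ = _ , k , q , k∈ , sym (val-this k)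
  splits-sound u {k} (0≤k , k≤u) (there (here (q ∷ q′ ∷ []))) | no _ with k ℤ.≟ 0ℤ
  ... | yes refl = _ , 0ℤ , q , zero∈ , sym (⟦𝟎⟧ (0ℤ ∷ ρ))
  ... | no k≢0 = _ , k - 1ℤ , q′ ,
    (ℤ.i≤j⇒0≤j-i (ℤ.i<j⇒suc[i]≤j (ℤ.≤∧≢⇒< 0≤k (k≢0 ∘ sym))) ,
     subst (k - 1ℤ ℤ.≤_) (sym (⟦pred⟧ u)) (ℤ.+-monoˡ-≤ -1ℤ k≤u)) ,
    sym (trans (val-next (k - 1ℤ)) (solve 1 (λ k → con 1ℤ :+ (k :- con 1ℤ) := k) refl k))
  splits-sound u {k} (0≤k , k≤u) (there (there (here (q ∷ q′ ∷ [])))) | no _ with k ℤ.≟ ⟦ u ⟧ ρ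
  ... | yes refl = _ , 0ℤ , q , zero∈ , sym (val-at u 0ℤ)
  ... | no k≢u = _ , k , q′ ,
    (0≤k , subst (k ℤ.≤_) (trans (ℤ.+-comm -1ℤ (⟦ u ⟧ ρ)) (sym (⟦pred⟧ u)))
      (ℤ.i<j⇒i≤pred[j] (ℤ.≤∧≢⇒< k≤u k≢u))) , sym (val-this k)

  edge-∈ : ∀ {c k s} → c ∈ cells → InRange (crange c) k → s ∈ spots c → evalSpots k s ∈ edges G
  edge-∈ {c} {k} {s} c∈ k∈ s∈ = ∈-concatMap⁺ hexEdges (lose (cell-hex c∈ k∈)
    (subst (evalSpots k s ∈_) (sym (hexEdges-spots c k)) (∈-map⁺ (evalSpots k) s∈)))

  -- The edge lies on a hexagon, the hexagon belongs to a cell, and `cells-covered` leads from there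
  -- to an edge family.
  edge-cover : ∀ {vw} → vw ∈ edges G → ∃₂ λ e k → e ∈ edgeFamilies × InRange (range e) k ×
    SameEdge vw (place (end₁ e) k , place (end₂ e) k)
  edge-cover {vw} vw∈ with h , h∈ , vw∈h ← find (∈-concatMap⁻ hexEdges {xs = hexes} vw∈)
    with c , c∈ , k , k∈ , refl ← find (hex-cell h∈)
    with s , s∈ , refl ← ∈-map⁻ (evalSpots k) (subst (vw ∈_) (hexEdges-spots c k) vw∈h)
    with e , e∈ , r ← find (All.lookup (All.lookup cells-covered c∈) s∈)
    with η , _ , eq , inside ← find r
    = e , val η k , e∈ , inside-sound (range e) η k∈ inside , same eq
    where
    same : s ≡ _ ⊎ s ≡ _ → _
    same (inj₁ refl) = inj₁ (evalSpot-place k (end₁ e) η , evalSpot-place k (end₂ e) η)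
    same (inj₂ refl) = inj₂ (evalSpot-place k (end₂ e) η , evalSpot-place k (end₁ e) η)

  edge-adj : ∀ {e k} → e ∈ edgeFamilies → InRange (range e) k → Adj G (place (end₁ e) k) (place (end₂ e) k)
  edge-adj {e} {k} e∈ k∈
    with (η , u) , j , present , j∈ , refl ← splits-sound (range e) k∈ (All.lookup edges-present e∈)
    with c , c∈ , refl , p ← find present
    with s , s∈ , eq ← find p = adj eq (edge-∈ c∈ j∈ s∈)
    where
    adj : s ≡ _ ⊎ s ≡ _ → evalSpots j s ∈ edges G → _
    adj (inj₁ refl) s∈G = inj₁ (subst (_∈ edges G)
      (cong₂ _,_ (evalSpot-place j (end₁ e) η) (evalSpot-place j (end₂ e) η)) s∈G)
    adj (inj₂ refl) s∈G = inj₂ (subst (_∈ edges G)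
      (cong₂ _,_ (evalSpot-place j (end₂ e) η) (evalSpot-place j (end₁ e) η)) s∈G)

  adj-verts : ∀ {v w} → Adj G v w → v ∈ verts G × w ∈ verts G
  adj-verts (inj₁ vw∈) with h , h∈ , e∈ ← find (∈-concatMap⁻ hexEdges {xs = hexes} vw∈)
    with v∈ , w∈ ← hexEdge-verts h e∈ =
    ∈-concatMap⁺ hexVerts (lose h∈ v∈) , ∈-concatMap⁺ hexVerts (lose h∈ w∈)
  adj-verts (inj₂ wv∈) with w∈ , v∈ ← adj-verts (inj₁ wv∈) = v∈ , w∈

  vert-adj : ∀ {v} → v ∈ verts G → ∃ λ w → Adj G v w
  vert-adj v∈ with h , h∈ , v∈h ← find (∈-concatMap⁻ hexVerts {xs = hexes} v∈) with hexVert-edge h v∈h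
  ... | w , inj₁ e∈ = w , inj₁ (∈-concatMap⁺ hexEdges (lose h∈ e∈))
  ... | w , inj₂ e∈ = w , inj₂ (∈-concatMap⁺ hexEdges (lose h∈ e∈))

  -- The distance function takes a family and an index; a name supplies them for a vertex, and
  -- `loc-injective` makes them unique.
  record Name (v : Vtx) : Set where
    constructor name
    field
      familyOf  : Family
      familyOf∈ : familyOf ∈ families
      index : ℤ
      index∈ : InRange (bound familyOf) index
      located : v ≡ loc familyOf index
  open Name

  apart-sound : ∀ {f g k j} → InRange (bound f) k → InRange (bound g) j → Apart f g → loc f k ≢ loc g j
  apart-sound {f} {g} {k} {j} k∈ j∈ sep eq =
    separated-sound (difference (locX f) (locX g) ∷ difference (locY f) (locY g) ∷ []) k∈ j∈ sep
      (trans (⟦difference⟧ (locX f) (locX g) k j) (ℤ.i≡j⇒i-j≡0 (cong proj₁ eq)) ∷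
       trans (⟦difference⟧ (locY f) (locY g) k j) (ℤ.i≡j⇒i-j≡0 (cong proj₂ eq)) ∷ [])

  val-injective : ∀ f {k j} → Vec.head f ≢ 0ℤ → val f k ≡ val f j → k ≡ j
  val-injective (c ∷ f) {k} {j} c≢0 eq =
    ℤ.*-cancelˡ-≡ c k j {{≢-nonZero c≢0}} (∙-cancelʳ (⟦ f ⟧ ρ) (c * k) (c * j) eq)

  loc-injective : ∀ {f g k j} → f ∈ families → g ∈ families → InRange (bound f) k → InRange (bound g) j →
    loc f k ≡ loc g j → f ≡ g × k ≡ j
  loc-injective {f} {g} f∈ g∈ k∈ j∈ eq with lookup-pair families-apart f∈ g∈
  ... | inj₂ (inj₁ sep) = contradiction eq (apart-sound {f} {g} k∈ j∈ sep)
  ... | inj₂ (inj₂ sep) = contradiction (sym eq) (apart-sound {g} {f} j∈ k∈ sep)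
  ... | inj₁ refl with All.lookup families-rigid f∈
  ...   | inj₂ moving = refl , val-injective (locX f) moving (cong proj₁ eq)
  ...   | inj₁ b≡𝟎 = refl ,
    trans (∈zero (subst (λ u → InRange u _) b≡𝟎 k∈)) (sym (∈zero (subst (λ u → InRange u _) b≡𝟎 j∈)))

  δ : Base → Family → ℤ → ℤ
  δ x f k = val (dist x f) k

  value : ∀ {v} → Base → Name v → ℤ
  value x p = δ x (familyOf p) (index p)

  value-unique : ∀ {v} x (p q : Name v) → value x p ≡ value x q
  value-unique x (name f f∈ k k∈ refl) (name g g∈ j j∈ eq) with refl , refl ← loc-injective f∈ g∈ k∈ j∈ eq = refl

  valid-name : ∀ {u} p {k} → InRange u k → Valid u p → Name (place p k)
  valid-name (point f ι) {k} k∈ (f∈ , inside) = name f f∈ (val ι k) (inside-sound (bound f) ι k∈ inside) refl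

  end₁-name : ∀ {e k} → e ∈ edgeFamilies → InRange (range e) k → Name (place (end₁ e) k)
  end₁-name {e} e∈ k∈ = valid-name (end₁ e) k∈ (proj₁ (All.lookup edges-valid e∈))

  end₂-name : ∀ {e k} → e ∈ edgeFamilies → InRange (range e) k → Name (place (end₂ e) k)
  end₂-name {e} e∈ k∈ = valid-name (end₂ e) k∈ (proj₂ (All.lookup edges-valid e∈))

  δ-place : Base → Point → ℤ → ℤ
  δ-place x p k = δ x (fam p) (val (idx p) k)

  val-distAt : ∀ x p k → val (distAt x p) k ≡ δ-place x p k
  val-distAt x p k = val-sub (dist x (fam p)) (idx p) k

  end-difference : ∀ {x e k c} → distAt x (end₁ e) ⊝ distAt x (end₂ e) ≡ at (const c) →
    δ-place x (end₁ e) k ≡ c + δ-place x (end₂ e) k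
  end-difference {x} {e} {k} {c} eq = begin
    p          ≡⟨ solve 2 (λ p q → p := (p :- q) :+ q) refl p q ⟩
    (p - q) + q ≡⟨ cong (_+ q) (begin
      p - q ≡⟨ cong₂ _-_ (val-distAt x (end₁ e) k) (val-distAt x (end₂ e) k) ⟨
      val (distAt x (end₁ e)) k - val (distAt x (end₂ e)) k ≡⟨ ⟦⊝⟧ (distAt x (end₁ e)) (distAt x (end₂ e)) (k ∷ ρ) ⟨
      val (distAt x (end₁ e) ⊝ distAt x (end₂ e)) k ≡⟨ cong (λ f → val f k) eq ⟩
      val (at (const c)) k ≡⟨ trans (val-at (const c) k) (⟦const⟧ c) ⟩
      c ∎) ⟩
    c + q ∎
    where
    open ≡-Reasoning
    p = δ-place x (end₁ e) k
    q = δ-place x (end₂ e) k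

  end-close : ∀ {x e k} → x ∈ bases → e ∈ edgeFamilies →
    δ-place x (end₁ e) k ℤ.≤ 1ℤ + δ-place x (end₂ e) k × δ-place x (end₂ e) k ℤ.≤ 1ℤ + δ-place x (end₁ e) k
  end-close {x} {e} {k} x∈ e∈ with c , c∈ , eq ← find (All.lookup (All.lookup dist-lipschitz x∈) e∈)
    rewrite end-difference {x} {e} {k} eq =
    ℤ.+-monoˡ-≤ q (proj₁ (bounds c∈)) ,
    subst₂ ℤ._≤_ (ℤ.+-identityˡ q) (ℤ.+-assoc 1ℤ c q) (ℤ.+-monoˡ-≤ q (proj₂ (bounds c∈)))
    where
    q = δ-place x (end₂ e) k
    bounds : ∀ {c} → c ∈ -1ℤ ∷ 0ℤ ∷ 1ℤ ∷ [] → c ℤ.≤ 1ℤ × 0ℤ ℤ.≤ 1ℤ + c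
    bounds (here refl) = -≤+ , +≤+ z≤n
    bounds (there (here refl)) = +≤+ z≤n , +≤+ z≤n
    bounds (there (there (here refl))) = ℤ.≤-refl , +≤+ z≤n

  record Step (v w : Vtx) : Set where
    field
      source-name : Name v
      target-name : Name w
      close       : ∀ {x} → x ∈ bases → value x source-name ℤ.≤ 1ℤ + value x target-name

  along₁ : ∀ {e k} → e ∈ edgeFamilies → InRange (range e) k → Step (place (end₁ e) k) (place (end₂ e) k)
  along₁ {e} {k} e∈ k∈ = record
    { source-name = end₁-name {e} {k} e∈ k∈
    ; target-name = end₂-name {e} {k} e∈ k∈
    ; close       = λ x∈ → proj₁ (end-close {e = e} {k} x∈ e∈) }

  along₂ : ∀ {e k} → e ∈ edgeFamilies → InRange (range e) k → Step (place (end₂ e) k) (place (end₁ e) k)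
  along₂ {e} {k} e∈ k∈ = record
    { source-name = end₂-name {e} {k} e∈ k∈
    ; target-name = end₁-name {e} {k} e∈ k∈
    ; close       = λ x∈ → proj₂ (end-close {e = e} {k} x∈ e∈) }

  edge-step : ∀ {v w} → (v , w) ∈ edges G → Step v w × Step w v
  edge-step vw∈ with e , k , e∈ , k∈ , same ← edge-cover vw∈ | same
  ... | inj₁ (refl , refl) = along₁ e∈ k∈ , along₂ e∈ k∈
  ... | inj₂ (refl , refl) = along₂ e∈ k∈ , along₁ e∈ k∈

  adj-step : ∀ {v w} → Adj G v w → Step v w
  adj-step (inj₁ vw∈) = proj₁ (edge-step vw∈)
  adj-step (inj₂ wv∈) = proj₂ (edge-step wv∈)

  vert-name : ∀ {v} → v ∈ verts G → Name v
  vert-name v∈ = Step.source-name (adj-step (proj₂ (vert-adj v∈)))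

  -- Induction on the walk: each edge lowers the value by at most 1, and `value-unique` reconciles
  -- the names given by consecutive edges.
  value-≤ : ∀ {x v w N} → x ∈ bases → Walk G v w N → (p : Name v) (q : Name w) → value x p ℤ.≤ + N + value x q
  value-≤ {x} x∈ (here _) p q = ℤ.≤-reflexive (trans (value-unique x p q) (sym (ℤ.+-identityˡ _)))
  value-≤ {x} x∈ (step {n = N} adj walk) p q = begin
    value x p                      ≡⟨ value-unique x p (source-name s) ⟩
    value x (source-name s)        ≤⟨ close s x∈ ⟩
    1ℤ + value x (target-name s)   ≤⟨ ℤ.+-monoʳ-≤ 1ℤ (value-≤ x∈ walk (target-name s) q) ⟩
    1ℤ + (+ N + value x q)         ≡⟨ ℤ.+-assoc 1ℤ (+ N) (value x q) ⟨
    + suc N + value x q            ∎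
    where
    open ℤ.≤-Reasoning
    open Step
    s = adj-step adj

  snoc : ∀ {v w u N} → Walk G v w N → Adj G w u → Walk G v u (suc N)
  snoc (here _) adj = step adj (here (proj₂ (adj-verts adj)))
  snoc (step adj walk) adj′ = step adj (snoc walk adj′)

  reverse : ∀ {v w N} → Walk G v w N → Walk G w v N
  reverse (here v∈) = here v∈
  reverse (step adj walk) = snoc (reverse walk) (Adj-sym {G} adj)

  basePos : Base → Vtx
  basePos x = ⟦ baseX x ⟧ ρ , ⟦ baseY x ⟧ ρ

  evalSpot-base : ∀ k x → evalSpot k (baseSpot x) ≡ basePos x
  evalSpot-base k x = cong₂ _,_ (val-at (baseX x) k) (val-at (baseY x) k)

  record Sound (d : Dart) : Set where
    field
      adj          : ∀ {k} → InRange (extent d) k → Adj G (place (source d) k) (place (target d) k)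
      source-valid : Valid (extent d) (source d)
      target-valid : Valid (extent d) (target d)

  dart-sound : ∀ {d} → d ∈ darts → Sound d
  dart-sound d∈ with find (∈-concatMap⁻ (λ (edge p q u) → dart p q u ∷ dart q p u ∷ []) {xs = edgeFamilies} d∈)
  ... | e , e∈ , here refl = record
    { adj = λ {k} k∈ → edge-adj {e} {k} e∈ k∈
    ; source-valid = proj₁ (All.lookup edges-valid e∈)
    ; target-valid = proj₂ (All.lookup edges-valid e∈) }
  ... | e , e∈ , there (here refl) = record
    { adj = λ {k} k∈ → Adj-sym {G} (edge-adj {e} {k} e∈ k∈)
    ; source-valid = proj₂ (All.lookup edges-valid e∈)
    ; target-valid = proj₁ (All.lookup edges-valid e∈) }

  rename : ∀ {v w} → v ≡ w → Name v → Name w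
  rename eq (name f f∈ k k∈ v≡) = name f f∈ k k∈ (trans (sym eq) v≡)

  record AtBase (x : Base) : Set where
    field
      base-name : Name (basePos x)
      base-vert : basePos x ∈ verts G
      base-zero : value x base-name ≡ 0ℤ

  at-base : ∀ {x} → x ∈ bases → AtBase x
  at-base {x} x∈ with d , d∈ , located ← find (All.lookup bases-located x∈)
    with η , _ , inside , eq , zero≡ ← find located = record
    { base-name = rename pos≡ (valid-name (source d) k∈ source-valid)
    ; base-vert = subst (_∈ verts G) pos≡ (proj₁ (adj-verts (adj k∈)))
    ; base-zero = begin
        δ-place x (source d) (val η 0ℤ)          ≡⟨ val-distAt x (source d) (val η 0ℤ) ⟨
        val (distAt x (source d)) (val η 0ℤ)     ≡⟨ val-sub (distAt x (source d)) η 0ℤ ⟨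
        val (sub (distAt x (source d)) η) 0ℤ     ≡⟨ cong (λ f → val f 0ℤ) zero≡ ⟩
        val 𝟎 0ℤ                                 ≡⟨ ⟦𝟎⟧ (0ℤ ∷ ρ) ⟩
        0ℤ                                       ∎
    }
    where
    open ≡-Reasoning
    open Sound (dart-sound d∈)
    k∈ = inside-sound (extent d) η zero∈ inside
    pos≡ : place (source d) (val η 0ℤ) ≡ basePos x
    pos≡ = trans (sym (evalSpot-place 0ℤ (source d) η)) (trans (cong (evalSpot 0ℤ) eq) (evalSpot-base 0ℤ x))

  value-nonnegative : ∀ {x v} → x ∈ bases → (p : Name v) → 0ℤ ℤ.≤ value x p
  value-nonnegative {x} x∈ (name f f∈ k k∈ _) =
    within-sound (dist x f) k∈ (proj₁ (All.lookup (All.lookup families-reachable f∈) x∈))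

  data Descent (x : Base) (v : Vtx) (z : ℤ) : Set where
    arrived : v ≡ basePos x → z ≡ 0ℤ → Descent x v z
    descend : ∀ {w} → Adj G v w → (q : Name w) → value x q ≡ z - 1ℤ → Descent x v z

  descent : ∀ {x v} → x ∈ bases → (p : Name v) → Descent x v (value x p)
  descent {x} x∈ (name f f∈ k k∈ refl)
    with (ι , u) , j , s , j∈ , refl ←
      splits-sound (bound f) k∈ (proj₂ (All.lookup (All.lookup families-reachable f∈) x∈))
    with s
  ... | inj₁ (x≡ , y≡ , z≡) = arrived
    (cong₂ _,_ (trans (sym (val-sub (locX f) ι j)) (trans (cong (λ g → val g j) x≡) (val-at (baseX x) j)))
               (trans (sym (val-sub (locY f) ι j)) (trans (cong (λ g → val g j) y≡) (val-at (baseY x) j))))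
    (trans (sym (val-sub (dist x f) ι j)) (trans (cong (λ g → val g j) z≡) (⟦𝟎⟧ (j ∷ ρ))))
  ... | inj₂ s with d , d∈ , ds ← find s
    with d∈darts , refl ← ∈-filter⁻ (λ d → fam (source d) ≟ᶠᵃᵐ f) {xs = darts} d∈
    with η , _ , κ≡ , inside , lower≡ ← find ds =
    descend (subst (λ v → Adj G v _) source≡ (adj i∈)) (valid-name (target d) i∈ target-valid) (begin
      δ-place x (target d) (val η j)                  ≡⟨ val-distAt x (target d) (val η j) ⟨
      val (distAt x (target d)) (val η j)             ≡⟨ val-sub (distAt x (target d)) η j ⟨
      val (sub (distAt x (target d)) η) j             ≡⟨ cong (λ g → val g j) lower≡ ⟩
      val (sub (dist x f) ι ⊝ at (const 1ℤ)) j        ≡⟨ ⟦⊝⟧ (sub (dist x f) ι) (at (const 1ℤ)) (j ∷ ρ) ⟩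
      val (sub (dist x f) ι) j - val (at (const 1ℤ)) j
        ≡⟨ cong₂ _-_ (val-sub (dist x f) ι j) (trans (val-at (const 1ℤ) j) (⟦const⟧ 1ℤ)) ⟩
      δ x f (val ι j) - 1ℤ                            ∎)
    where
    open ≡-Reasoning
    open Sound (dart-sound d∈darts)
    i∈ = inside-sound (extent d) η j∈ inside
    source≡ : place (source d) (val η j) ≡ loc f (val ι j)
    source≡ = cong (loc f) (trans (sym (val-sub (idx (source d)) η j)) (cong (λ g → val g j) κ≡))

  to-base : ∀ {x v} N → x ∈ bases → (p : Name v) → value x p ≡ + N → Walk G v (basePos x) N
  to-base {x} N x∈ p eq with descent x∈ p
  to-base zero x∈ p eq | arrived refl _ = here (AtBase.base-vert (at-base x∈))
  to-base (suc N) x∈ p eq | arrived _ z≡ with () ← trans (sym z≡) eq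
  -- A descent from value 0 would give the next vertex the value -1.
  to-base zero x∈ p eq | descend _ q q≡
    with () ← subst (0ℤ ℤ.≤_) (trans q≡ (cong (_- 1ℤ) eq)) (value-nonnegative x∈ q)
  to-base (suc N) x∈ p eq | descend adj q q≡ = step adj (to-base N x∈ q (trans q≡ (cong (_- 1ℤ) eq)))

  walk-length : ∀ {x v N} → x ∈ bases → (p : Name v) → Walk G v (basePos x) N → value x p ℤ.≤ + N
  walk-length {x} {N = N} x∈ p walk = subst (value x p ℤ.≤_)
    (trans (cong (λ z → + N + z) base-zero) (ℤ.+-identityʳ (+ N))) (value-≤ x∈ walk p base-name)
    where open AtBase (at-base x∈)

  record Distance (x : Base) {v : Vtx} (p : Name v) : Set where
    field
      number : ℕ
      value≡ : value x p ≡ + number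
      inward : IsDist G v (basePos x) number
      outward : IsDist G (basePos x) v number

  distance : ∀ {x v} → x ∈ bases → (p : Name v) → Distance x p
  distance {x} x∈ p with value x p in eq | value-nonnegative x∈ p
  ... | + N | _ = record
    { number = N
    ; value≡ = eq
    ; inward = to-base N x∈ p eq , (λ M w → drop‿+≤+ (subst (ℤ._≤ + M) eq (walk-length x∈ p w)))
    ; outward = reverse (to-base N x∈ p eq) , (λ M w → drop‿+≤+ (subst (ℤ._≤ + M) eq (walk-length x∈ p (reverse w))))
    }

  IsDist-unique : ∀ {v w M N} → IsDist G v w M → IsDist G v w N → M ≡ N
  IsDist-unique (walk , min) (walk′ , min′) = ℕ.≤-antisym (min _ walk′) (min′ _ walk)

-- The edge metric dimension

pairs-∈ : ∀ {X : Set} {xs : List X} {x y} → (x , y) ∈ pairs xs → x ∈ xs × y ∈ xs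
pairs-∈ {xs = z ∷ xs} p with Any.++⁻ (map (z ,_) xs) p
... | inj₁ q with _ , y∈ , refl ← ∈-map⁻ (z ,_) q = here refl , there y∈
... | inj₂ q with x∈ , y∈ ← pairs-∈ q = there x∈ , there y∈

SameEdge-join : ∀ {d e f} → SameEdge d f → SameEdge e f → SameEdge d e
SameEdge-join (inj₁ (refl , refl)) (inj₁ (refl , refl)) = inj₁ (refl , refl)
SameEdge-join (inj₁ (refl , refl)) (inj₂ (refl , refl)) = inj₂ (refl , refl)
SameEdge-join (inj₂ (refl , refl)) (inj₁ (refl , refl)) = inj₂ (refl , refl)
SameEdge-join (inj₂ (refl , refl)) (inj₂ (refl , refl)) = inj₁ (refl , refl)

SameEdge-sym : ∀ {d e} → SameEdge d e → SameEdge e d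
SameEdge-sym (inj₁ (refl , refl)) = inj₁ (refl , refl)
SameEdge-sym (inj₂ (refl , refl)) = inj₂ (refl , refl)

record SharedTie (v w : Vtx) : Set where
  field
    {cluster}       : Junction
    {first second}  : Bond
    bonded          : Bonded cluster first
    bonded′         : Bonded cluster second
    distinct        : Distinct (first , second)
    tieˡ            : Tie v (cluster , first , second)
    tieʳ            : Tie w (cluster , first , second)

bondPair-∈ : ∀ {t} → t ∈ bondPairs → ∃₂ λ P p → P ∈ clusters × p ∈ pairs (bonds P) × t ≡ (P , p)
bondPair-∈ t∈ with P , P∈ , q ← find (∈-concatMap⁻ (λ P → map (P ,_) (pairs (bonds P))) {xs = clusters} t∈)
  with p , p∈ , eq ← ∈-map⁻ (P ,_) q = P , p , P∈ , p∈ , eq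

shared : ∀ {v w t} → t ∈ bondPairs → Tie v t → Tie w t → SharedTie v w
shared t∈ tieˡ tieʳ with P , p , P∈ , p∈ , refl ← bondPair-∈ t∈ = record
  { bonded = All.lookup (All.lookup bonds-bonded P∈) (proj₁ (pairs-∈ p∈))
  ; bonded′ = All.lookup (All.lookup bonds-bonded P∈) (proj₂ (pairs-∈ p∈))
  ; distinct = All.lookup (All.lookup bonds-distinct P∈) p∈
  ; tieˡ = tieˡ ; tieʳ = tieʳ }

shared-tie : ∀ {f g} → f ∈ families → g ∈ families → SharedTie (core f) (core g)
shared-tie {f} {g} f∈ g∈ = shared {core f} {core g} {proj₁ t} (proj₁ in-pairs) (proj₂ in-pairs) (proj₂ (proj₂ t))
  where
  t = find (All.lookup (All.lookup common-ties (∈-map⁺ core f∈)) (∈-map⁺ core g∈))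
  in-pairs = ∈-filter⁻ (tie? (core f)) {xs = bondPairs} (proj₁ (proj₂ t))

-- The edge list fixes some orientation, which need not be that of the bond; `actual` is the pair as
-- listed.
record Oriented (G : Graph) (vw : Vtx × Vtx) : Set where
  field
    actual  : Vtx × Vtx
    actual∈ : actual ∈ edges G
    same    : SameEdge actual vw
open Oriented

orient : ∀ {G v w} → Adj G v w → Oriented G (v , w)
orient (inj₁ e∈) = record { actual∈ = e∈ ; same = inj₁ (refl , refl) }
orient (inj₂ e∈) = record { actual∈ = e∈ ; same = inj₂ (refl , refl) }

record Unresolved (G : Graph) (α β : Vtx) : Set where
  field
    {one two} : Vtx × Vtx
    one∈      : one ∈ edges G
    two∈      : two ∈ edges G
    apart     : ¬ SameEdge one two
    blindˡ    : ¬ Resolves G α one two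
    blindʳ    : ¬ Resolves G β one two
open Unresolved

at-least-three : ∀ {G v} → v ∈ verts G → (∀ {α β} → α ∈ verts G → β ∈ verts G → Unresolved G α β) →
  ∀ U → IsEdgeMetricGenerator G U → 3 ℕ.≤ length U
-- `un` takes two vertices: the empty list uses `v` twice, a singleton repeats its only entry.
at-least-three v∈ un [] (_ , _ , resolves)
  with u ← un v∈ v∈ with () ← resolves _ _ (one∈ u) (two∈ u) (apart u)
at-least-three v∈ un (α ∷ []) (_ , α∈ ∷ [] , resolves)
  with u ← un α∈ α∈ with resolves _ _ (one∈ u) (two∈ u) (apart u)
... | here r = contradiction r (blindˡ u)
at-least-three v∈ un (α ∷ β ∷ []) (_ , α∈ ∷ β∈ ∷ [] , resolves)
  with u ← un α∈ β∈ with resolves _ _ (one∈ u) (two∈ u) (apart u)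
... | here r = contradiction r (blindˡ u)
... | there (here r) = contradiction r (blindʳ u)
at-least-three v∈ un (_ ∷ _ ∷ _ ∷ _) _ = s≤s (s≤s (s≤s z≤n))

module Dimension (l m n : ℕ) where

  open Geometry l m n
  open Metric l m n
  open Distance

  -- The end chosen in `edgeDist` is decided by the sign of a constant difference, which
  -- `dist-lipschitz` provides.
  val-edgeDist : ∀ {x e} k → x ∈ bases → e ∈ edgeFamilies →
    val (edgeDist x e) k ≡ δ-place x (end₁ e) k ⊓ δ-place x (end₂ e) k
  val-edgeDist {x} {e} k x∈ e∈ with find (All.lookup (All.lookup dist-lipschitz x∈) e∈)
  ... | c , c∈ , eq rewrite eq = cases c∈ (end-difference {x} {e} {k} eq)
    where
    p = δ-place x (end₁ e) k
    q = δ-place x (end₂ e) k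
    cases : ∀ {c} → c ∈ -1ℤ ∷ 0ℤ ∷ 1ℤ ∷ [] → p ≡ c + q →
      val (if does (c ℤ.≤? 0ℤ) then distAt x (end₁ e) else distAt x (end₂ e)) k ≡ p ⊓ q
    cases (here refl) p≡ = trans (val-distAt x (end₁ e) k)
      (sym (ℤ.i≤j⇒i⊓j≡i (subst₂ ℤ._≤_ (sym p≡) (ℤ.+-identityˡ q) (ℤ.+-monoˡ-≤ q -≤+))))
    cases (there (here refl)) p≡ = trans (val-distAt x (end₁ e) k)
      (sym (ℤ.i≤j⇒i⊓j≡i (ℤ.≤-reflexive (trans p≡ (ℤ.+-identityˡ q)))))
    cases (there (there (here refl))) p≡ = trans (val-distAt x (end₂ e) k)
      (sym (ℤ.i≥j⇒i⊓j≡j (subst₂ ℤ._≤_ (ℤ.+-identityˡ q) (sym p≡) (ℤ.+-monoˡ-≤ q (+≤+ z≤n)))))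

  edge-distance : ∀ {x e k vw} → x ∈ bases → e ∈ edgeFamilies → InRange (range e) k →
    SameEdge vw (place (end₁ e) k , place (end₂ e) k) →
    ∃ λ K → IsEDist G (basePos x) vw K × + K ≡ val (edgeDist x e) k
  edge-distance {x} {e} {k} x∈ e∈ k∈ same = M ℕ.⊓ N , isEDist same ,
    trans (cong₂ _⊓_ (sym (value≡ d₁)) (sym (value≡ d₂))) (sym (val-edgeDist k x∈ e∈))
    where
    d₁ = distance x∈ (end₁-name {e} e∈ k∈)
    d₂ = distance x∈ (end₂-name {e} e∈ k∈)
    M = number d₁
    N = number d₂
    isEDist : ∀ {vw} → SameEdge vw (place (end₁ e) k , place (end₂ e) k) → IsEDist G (basePos x) vw (M ℕ.⊓ N)
    isEDist (inj₁ (refl , refl)) = M , N , outward d₁ , outward d₂ , refl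
    isEDist (inj₂ (refl , refl)) = N , M , outward d₂ , outward d₁ , ℕ.⊓-comm M N

  module _ {e e′ k k′ vw vw′} (e∈ : e ∈ edgeFamilies) (e′∈ : e′ ∈ edgeFamilies)
           (k∈ : InRange (range e) k) (k′∈ : InRange (range e′) k′)
           (same : SameEdge vw (place (end₁ e) k , place (end₂ e) k))
           (same′ : SameEdge vw′ (place (end₁ e′) k′ , place (end₂ e′) k′)) where

    Agree : Base → Set
    Agree x = val (edgeDist x e) k ≡ val (edgeDist x e′) k′

    resolve-or-agree : ∀ {xs} → All (_∈ bases) xs →
      Any (λ α → Resolves G α vw vw′) (map basePos xs) ⊎ All Agree xs
    resolve-or-agree [] = inj₂ []
    resolve-or-agree (x∈ ∷ xs∈) with edge-distance {e = e} x∈ e∈ k∈ same | edge-distance {e = e′} x∈ e′∈ k′∈ same′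
    ... | K , isK , K≡ | K′ , isK′ , K′≡ with K ℕ.≟ K′
    ... | no K≢K′ = inj₁ (here (K , K′ , isK , isK′ , K≢K′))
    ... | yes refl with resolve-or-agree xs∈
    ...   | inj₁ r = inj₁ (there r)
    ...   | inj₂ as = inj₂ (trans (sym K≡) K′≡ ∷ as)

    zipDiff-vanishes : ∀ {xs} → All Agree xs →
      All (λ f → ⟦ f ⟧ (k′ ∷ k ∷ ρ) ≡ 0ℤ) (zipDiff (map (λ x → edgeDist x e) xs) (map (λ x → edgeDist x e′) xs))
    zipDiff-vanishes [] = []
    zipDiff-vanishes {x ∷ _} (eq ∷ eqs) =
      trans (⟦difference⟧ (edgeDist x e) (edgeDist x e′) k k′) (ℤ.i≡j⇒i-j≡0 eq) ∷ zipDiff-vanishes eqs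

    unresolved : Resolved (label e) (label e′) → ¬ All Agree landmarks
    unresolved sep agree = separated-sound
      (zipDiff (map (λ x → edgeDist x e) landmarks) (map (λ x → edgeDist x e′) landmarks))
      k∈ k′∈ sep (zipDiff-vanishes agree)

  agree-same : ∀ {e k k′} → e ∈ edgeFamilies → InRange (range e) k → InRange (range e) k′ →
    All (λ x → val (edgeDist x e) k ≡ val (edgeDist x e) k′) landmarks → k ≡ k′
  agree-same {e} e∈ k∈ k′∈ agree with All.lookup edges-rigid e∈
  ... | inj₁ r≡𝟎 =
    trans (∈zero (subst (λ u → InRange u _) r≡𝟎 k∈)) (sym (∈zero (subst (λ u → InRange u _) r≡𝟎 k′∈)))
  ... | inj₂ r with x , x∈ , c≢0 ← find r = val-injective (edgeDist x e) c≢0 (All.lookup agree x∈)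

  resolving : ∀ vw vw′ → vw ∈ edges G → vw′ ∈ edges G → ¬ SameEdge vw vw′ →
    Any (λ α → Resolves G α vw vw′) (map basePos landmarks)
  resolving vw vw′ vw∈ vw′∈ ≢
    with e , k , e∈ , k∈ , same ← edge-cover vw∈ | e′ , k′ , e′∈ , k′∈ , same′ ← edge-cover vw′∈
    with resolve-or-agree e∈ e′∈ k∈ k′∈ same same′ landmarks-bases
  ... | inj₁ r = r
  -- Equal labels exclude different families; within one family they force equal indices, so the two
  -- edges would coincide.
  ... | inj₂ agree with lookup-pair (AllPairs.map⁻ edges-resolved) e∈ e′∈
  ...   | inj₂ (inj₁ sep) = contradiction agree (unresolved e∈ e′∈ k∈ k′∈ same same′ sep)
  ...   | inj₂ (inj₂ sep) = contradiction (All.map sym agree) (unresolved e′∈ e∈ k′∈ k∈ same′ same sep)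
  ...   | inj₁ refl with refl ← agree-same e∈ k∈ k′∈ agree = contradiction (SameEdge-join same same′) ≢

  elsewhere-sound : ∀ {x y} → Elsewhere x y → basePos x ≢ basePos y
  elsewhere-sound {x} {y} sep eq = separated-sound
    (difference (at (baseX x)) (at (baseX y)) ∷ difference (at (baseY x)) (at (baseY y)) ∷ []) zero∈ zero∈ sep
    (vanish (baseX x) (baseX y) (cong proj₁ eq) ∷ vanish (baseY x) (baseY y) (cong proj₂ eq) ∷ [])
    where
    vanish : ∀ f g → ⟦ f ⟧ ρ ≡ ⟦ g ⟧ ρ → ⟦ difference (at f) (at g) ⟧ (0ℤ ∷ 0ℤ ∷ ρ) ≡ 0ℤ
    vanish f g f≡g = trans (⟦difference⟧ (at f) (at g) 0ℤ 0ℤ)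
      (ℤ.i≡j⇒i-j≡0 (trans (val-at f 0ℤ) (trans f≡g (sym (val-at g 0ℤ)))))

  generator : IsEdgeMetricGenerator G (map basePos landmarks)
  generator = AllPairs.map⁺ (AllPairs.map elsewhere-sound landmarks-elsewhere) ,
    All.map⁺ (All.map (λ x∈ → AtBase.base-vert (at-base x∈)) landmarks-bases) , resolving

  value-lattice : ∀ P v {w} (p : Name w) →
    value (P , v) p ≡ lattice v (core (Name.familyOf p)) + val (stretch P (Name.familyOf p)) (Name.index p)
  value-lattice P v (name f _ k _ _) = trans (⟦⊕⟧ (at (const (lattice v (core f)))) (stretch P f) (k ∷ ρ))
    (cong (_+ val (stretch P f) k) (trans (val-at (const (lattice v (core f))) k) (⟦const⟧ (lattice v (core f)))))

  -- The stretch depends only on `P` and the name of `α`, so it is the same for both ends and can be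
  -- taken out of the minimum.
  bond-distance : ∀ {P v w α K} (p : Name α) → (P , v) ∈ bases → (P , w) ∈ bases →
    IsEDist G α (basePos (P , v) , basePos (P , w)) K →
    + K ≡ fromBond (v , w) (core (Name.familyOf p)) + val (stretch P (Name.familyOf p)) (Name.index p)
  bond-distance {P} {v} {w} p v∈ w∈ (M , N , isM , isN , refl) = begin
    + M ⊓ + N                  ≡⟨ cong₂ _⊓_ (to-value v∈ isM) (to-value w∈ isN) ⟩
    (lattice v v₀ + s) ⊓ (lattice w v₀ + s) ≡⟨ ℤ.mono-≤-distrib-⊓ (ℤ.+-monoˡ-≤ s) (lattice v v₀) (lattice w v₀) ⟨
    fromBond (v , w) v₀ + s ∎
    where
    open ≡-Reasoning
    v₀ = core (Name.familyOf p)
    s = val (stretch P (Name.familyOf p)) (Name.index p)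
    to-value : ∀ {v N} → (P , v) ∈ bases → IsDist G _ (basePos (P , v)) N → + N ≡ lattice v v₀ + s
    to-value {v} v∈ isN =
      trans (cong +_ (IsDist-unique isN (inward d))) (trans (sym (value≡ d)) (value-lattice P v p))
      where d = distance v∈ p

  basePos-injective : ∀ P {v w} → basePos (P , v) ≡ basePos (P , w) → v ≡ w
  basePos-injective P {x , y} {x′ , y′} eq =
    cong₂ _,_ (cancel x x′ (shiftX P) (cong proj₁ eq)) (cancel y y′ (shiftY P) (cong proj₂ eq))
    where
    cancel : ∀ x y f → ⟦ const x ⊕ f ⟧ ρ ≡ ⟦ const y ⊕ f ⟧ ρ → x ≡ y
    cancel x y f eq = ∙-cancelʳ (⟦ f ⟧ ρ) x y
      (trans (sym (expand x)) (trans eq (expand y)))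
      where
      expand : ∀ z → ⟦ const z ⊕ f ⟧ ρ ≡ z + ⟦ f ⟧ ρ
      expand z = trans (⟦⊕⟧ (const z) f ρ) (cong (_+ ⟦ f ⟧ ρ) (⟦const⟧ z))

  bonded-adj : ∀ {P v w} → Bonded P (v , w) → Adj G (basePos (P , v)) (basePos (P , w))
  bonded-adj {P} {v} {w} (_ , _ , r) with e , e∈ , s ← find r with η , _ , eq , inside ← find s
    with adj ← edge-adj {e} e∈ (inside-sound (range e) η zero∈ inside) with eq
  ... | inj₁ eq = subst₂ (Adj G) (place≡ (end₁ e) (cong proj₁ eq)) (place≡ (end₂ e) (cong proj₂ eq)) adj
    where
    place≡ : ∀ p {x} → baseSpot x ≡ subˢ (spot p) η → place p (val η 0ℤ) ≡ basePos x
    place≡ p {x} eq = trans (sym (evalSpot-place 0ℤ p η)) (trans (cong (evalSpot 0ℤ) (sym eq)) (evalSpot-base 0ℤ x))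
  ... | inj₂ eq = Adj-sym {G} (subst₂ (Adj G) (place≡ (end₁ e) (cong proj₂ eq)) (place≡ (end₂ e) (cong proj₁ eq)) adj)
    where
    place≡ : ∀ p {x} → baseSpot x ≡ subˢ (spot p) η → place p (val η 0ℤ) ≡ basePos x
    place≡ p {x} eq = trans (sym (evalSpot-place 0ℤ p η)) (trans (cong (evalSpot 0ℤ) (sym eq)) (evalSpot-base 0ℤ x))

  IsEDist-same : ∀ {α e e′ K} → SameEdge e e′ → IsEDist G α e K → IsEDist G α e′ K
  IsEDist-same (inj₁ (refl , refl)) isK = isK
  IsEDist-same (inj₂ (refl , refl)) (M , N , isM , isN , K≡) = N , M , isN , isM , trans K≡ (ℕ.⊓-comm M N)

  bondPos : Junction → Bond → Vtx × Vtx
  bondPos P (v , w) = basePos (P , v) , basePos (P , w)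

  Realised : Junction → Bond → Set
  Realised P d = Oriented G (bondPos P d)

  realised : ∀ {P d} → Bonded P d → Realised P d
  realised {P} {d} bonded = orient (bonded-adj {P} {proj₁ d} {proj₂ d} bonded)

  -- Both bonds lie in one cluster and so receive the same stretch; a tie in the core remains a tie
  -- in the graph.
  blind : ∀ {P d d′ α} (p : Name α) → Bonded P d → Bonded P d′ → (r : Realised P d) (r′ : Realised P d′) →
    Tie (core (Name.familyOf p)) (P , d , d′) → ¬ Resolves G α (actual r) (actual r′)
  blind {P} {d} {d′} p (v∈ , w∈ , _) (v′∈ , w′∈ , _) r r′ tie (K , K′ , isK , isK′ , K≢K′) =
    K≢K′ (ℤ.+-injective (begin
    + K                    ≡⟨ bond-distance p v∈ w∈ (IsEDist-same (same r) isK) ⟩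
    fromBond d v₀ + s      ≡⟨ cong (_+ s) tie ⟩
    fromBond d′ v₀ + s     ≡⟨ bond-distance p v′∈ w′∈ (IsEDist-same (same r′) isK′) ⟨
    + K′                   ∎))
    where
    open ≡-Reasoning
    v₀ = core (Name.familyOf p)
    s = val (stretch P (Name.familyOf p)) (Name.index p)

  bondPos-apart : ∀ {P d d′} → Distinct (d , d′) → ¬ SameEdge (bondPos P d) (bondPos P d′)
  bondPos-apart {P} (d≢d′ , _) (inj₁ (p , q)) = d≢d′ (cong₂ _,_ (basePos-injective P p) (basePos-injective P q))
  bondPos-apart {P} (_ , d≢swap) (inj₂ (p , q)) = d≢swap (cong₂ _,_ (basePos-injective P p) (basePos-injective P q))

  realised-apart : ∀ {P d d′} → Distinct (d , d′) → (r : Realised P d) (r′ : Realised P d′) →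
    ¬ SameEdge (actual r) (actual r′)
  realised-apart {P} {d} {d′} distinct r r′ eq = bondPos-apart {P} {d} {d′} distinct
    (SameEdge-join (SameEdge-sym (same r)) (SameEdge-sym (SameEdge-join eq (SameEdge-sym (same r′)))))

  named-insufficient : ∀ {α β} → Name α → Name β → Unresolved G α β
  named-insufficient p q = record
    { one∈ = actual∈ r
    ; two∈ = actual∈ r′
    ; apart = realised-apart {cluster} {first} {second} distinct r r′
    ; blindˡ = blind {cluster} {first} {second} p bonded bonded′ r r′ tieˡ
    ; blindʳ = blind {cluster} {first} {second} q bonded bonded′ r r′ tieʳ }
    where
    open SharedTie (shared-tie (Name.familyOf∈ p) (Name.familyOf∈ q))
    r = realised {cluster} {first} bonded
    r′ = realised {cluster} {second} bonded′

  two-insufficient : ∀ {α β} → α ∈ verts G → β ∈ verts G → Unresolved G α β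
  two-insufficient α∈ β∈ = named-insufficient (vert-name α∈) (vert-name β∈)

  root : basePos (P₁ , (+ 0 , + 2)) ∈ verts G
  root = AtBase.base-vert (at-base (All.lookup landmarks-bases (here refl)))

  dimension : EdgeMetricDim G 3
  dimension = (map basePos landmarks , refl , generator) , at-least-three root two-insufficient

theorem3 : ∀ (a b c : ℕ) → 4 ≤ a → 4 ≤ b → 4 ≤ c → EdgeMetricDim (FCS a b c) 3
theorem3 a b c 4≤a 4≤b 4≤c = go (ℕ.m≤n⇒∃[o]m+o≡n 4≤a) (ℕ.m≤n⇒∃[o]m+o≡n 4≤b) (ℕ.m≤n⇒∃[o]m+o≡n 4≤c)
  where
  go : (∃ λ l → 4 ℕ.+ l ≡ a) → (∃ λ m → 4 ℕ.+ m ≡ b) → (∃ λ n → 4 ℕ.+ n ≡ c) → EdgeMetricDim (FCS a b c) 3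
  -- With a = 4 + l the ribbon length a - 3 is `suc l`, in the range for which the forms were
  -- checked.
  go (l , refl) (m , refl) (n , refl) = Dimension.dimension l m n
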